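{- Let $k,n$ be positive integers with $\gcd(k,n)=1$. Let $v_1,v_2\in\mathbb{F}_{2^n}$ be distinct and nonzero, $v_3=v_1+v_2$, $\rho=v_2/v_1$ (so $\rho\notin\{0,1\}$), and $\sigma=1+\rho=v_3/v_1$. Then $$N(v_1,v_2)=2^{2n-3}+2^{ -n}Z(\rho),\qquad Z(\rho):=\sum_{\lambda\in\mathbb{F}_{2^n}^{*}}S(\lambda)\,S(\lambda\rho)\,S(\lambda\sigma).$$ In particular $N(v_1,v_2)=N(1,\rho)$ depends only on $\rho$, and the statement "$N(v_1,v_2)=2^{2n-3}$ for all distinct nonzero $v_1,v_2\in\mathbb{F}_{2^n}$" is equivalent to $$Z(\rho)=0\quad\text{for all }\rho\in\mathbb{F}_{2^n}\setminus\{0,1\}.$$ Moreover, $N(1,\rho)$ (as a function of $\rho\in\mathbb{F}_{2^n}\setminus\{0,1\}$) is invariant under the $S_3$-action generated by $\rho\mapsto 1/\rho$ and $\rho\mapsto 1+\rho$.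
   Context: $\mathbb{F}_{2^n}$ is the field with $2^n$ elements, $\operatorname{Tr}(x)=\sum_{i=0}^{n-1}x^{2^i}$ is the absolute trace (with values in $\mathbb{F}_2$), and $\chi(x)=(-1)^{\operatorname{Tr}(x)}$. Put $F(x)=x^{4^k-2^k+1}$ for $x\in\mathbb{F}_{2^n}$, $\delta(b)=F(b)+F(b+1)+1$, $\Delta=\{\delta(b): b\in\mathbb{F}_{2^n}\}$, and $S(a)=\sum_{t\in\Delta}\chi(at)$ for $a\in\mathbb{F}_{2^n}$. For distinct nonzero $v_1,v_2$, $$N(v_1,v_2)=\bigl|\{(x,y,z)\in\Delta^3:\ v_1x+v_2y+(v_1+v_2)z=0\}\bigr|.$$ -}

module Defs where

open import Algebra.Apartness.Structures using (IsHeytingField)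
open import Algebra.Bundles using (CommutativeRing; Semiring)
open import Algebra.Core using (Op₁; Op₂)
import Algebra.Definitions.RawSemiring as RawSemiringDefs
open import Data.Bool.Base using (if_then_else_)
open import Data.Fin.Base using (Fin; toℕ)
open import Data.Fin.Permutation using (Permutation′; _∘ₚ_) renaming (id to idₚ; _≈_ to _≈ₚ_)
open import Data.Fin.Properties using (inj⇒≟)
open import Data.Integer.Base as ℤ using (ℤ; +_; -[1+_]; 0ℤ; 1ℤ; -1ℤ)
open import Data.List.Base using (List; map; filter; foldr; length; tabulate; deduplicate; cartesianProduct)
open import Data.Nat.Base as ℕ using (ℕ; suc)
open import Data.Nat.Properties using (m^n≢0)
open import Data.Product.Base using (_×_; _,_; proj₁)
open import Data.Rational.Base as ℚ using (ℚ)
open import Function.Bundles using (_↔_; Inverse)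
open import Function.Properties.Inverse using (↔⇒↣; ↔-sym)
open import Level using (_⊔_) renaming (suc to lsuc)
open import Relation.Binary.Definitions using (DecidableEquality)
open import Relation.Binary.PropositionalEquality using (_≡_; _≢_)
open import Relation.Nullary.Decidable using (yes; no; does; ¬?)
open import Relation.Unary using (Pred)

-- A Heyting field whose apartness is _≢_ is a field in the usual sense; the
-- enumeration says that it has exactly q elements.

record FiniteField c (q : ℕ) : Set (lsuc c) where
  infix  8 -_
  infixl 7 _*_
  infixl 6 _+_
  field
    Carrier        : Set c
    _+_ _*_        : Op₂ Carrier
    -_             : Op₁ Carrier
    0# 1#          : Carrier
    isHeytingField : IsHeytingField _≡_ _≢_ _+_ _*_ -_ 0# 1#
    enumeration    : Fin q ↔ Carrier

  open IsHeytingField isHeytingField public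

  commutativeRing : CommutativeRing c c
  commutativeRing = record { isCommutativeRing = isCommutativeRing }

  open RawSemiringDefs (Semiring.rawSemiring (CommutativeRing.semiring commutativeRing)) public
    using (_^_; sum)

  infix 4 _≟_
  _≟_ : DecidableEquality Carrier
  _≟_ = inj⇒≟ (↔⇒↣ (↔-sym enumeration))

  elements : List Carrier
  elements = tabulate (Inverse.to enumeration)

  -- Total by the convention 0⁻¹ = 0.  The library states invertibility of
  -- differences, hence the argument x - 0#.
  infix 8 _⁻¹
  _⁻¹ : Op₁ Carrier
  x ⁻¹ with x ≟ 0#
  ... | yes _   = 0#
  ... | no  x≢0 = proj₁ (#⇒invertible x≢0)

  infixl 7 _/_
  _/_ : Op₂ Carrier
  x / y = x * y ⁻¹

∑ : ∀ {a} {A : Set a} → List A → (A → ℤ) → ℤ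
∑ xs f = foldr ℤ._+_ 0ℤ (map f xs)

syntax ∑ xs (λ x → e) = ∑[ x ∈ xs ] e

2^_ : ℤ → ℚ
2^ (+ m)      = (+ (2 ℕ.^ m)) ℚ./ 1
2^ (-[1+ m ]) = ℚ._/_ 1ℤ (2 ℕ.^ suc m) {{m^n≢0 2 (suc m)}}

fromℤ : ℤ → ℚ
fromℤ i = i ℚ./ 1

fromℕ : ℕ → ℚ
fromℕ m = fromℤ (+ m)

module Kasami {c} (n k : ℕ) (𝔽 : FiniteField c (2 ℕ.^ n)) where
  open FiniteField 𝔽

  Tr : Carrier → Carrier
  Tr x = sum {n} (λ i → x ^ (2 ℕ.^ toℕ i))

  -- Tr x is 0# or 1#, so this is (-1) ^ Tr x.
  χ : Carrier → ℤ
  χ x = if does (Tr x ≟ 0#) then 1ℤ else -1ℤ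

  F : Carrier → Carrier
  F x = x ^ (4 ℕ.^ k ℕ.∸ 2 ℕ.^ k ℕ.+ 1)

  δ : Carrier → Carrier
  δ b = F b + F (b + 1#) + 1#

  -- The image of δ as a set: each value is listed once.
  Δ : List Carrier
  Δ = deduplicate _≟_ (map δ elements)

  S : Carrier → ℤ
  S a = ∑[ t ∈ Δ ] χ (a * t)

  N : Carrier → Carrier → ℕ
  N v₁ v₂ = length
    (filter (λ (x , y , z) → v₁ * x + v₂ * y + (v₁ + v₂) * z ≟ 0#)
            (cartesianProduct Δ (cartesianProduct Δ Δ)))

  Z : Carrier → ℤ
  Z ρ = ∑[ l ∈ filter (λ l → ¬? (l ≟ 0#)) elements ]
          (S l ℤ.* S (l * ρ) ℤ.* S (l * (1# + ρ)))

  ≢0,1 : Pred Carrier c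
  ≢0,1 ρ = ρ ≢ 0# × ρ ≢ 1#

-- An action of the symmetric group S₃ on the subset P of X.  Here
-- τ ∘ₚ π means "first τ, then π", so this is a left action in the usual convention.

record S₃-Action {x p} {X : Set x} (P : Pred X p) : Set (x ⊔ p) where
  field
    act      : Permutation′ 3 → X → X
    act-P    : ∀ π {x} → P x → P (act π x)
    act-cong : ∀ {π τ} → π ≈ₚ τ → ∀ {x} → P x → act π x ≡ act τ x
    act-id   : ∀ {x} → P x → act idₚ x ≡ x
    act-∘    : ∀ π τ {x} → P x → act (τ ∘ₚ π) x ≡ act π (act τ x)

{-# OPTIONS --safe #-}
module Submission where

-- Orthogonality of the characters x ↦ χ(λx) counts the solutions as
-- 2ⁿ N(v₁, v₂) = Σ_λ S(λv₁) S(λv₂) S(λ(v₁ + v₂)).  The term λ = 0 is |Δ|³, and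
-- λ ↦ λ/v₁ turns the other terms into Z(ρ).  The summand is symmetric in v₁, v₂
-- and v₁ + v₂, whence the S₃-invariance.
--
-- That |Δ| = 2ⁿ⁻¹ means that δ is two-to-one.  Put φ(x) = x^(2^k), an automorphism with
-- fixed field 𝔽₂, and υ(b) = φ(b) + b; then φ(b² + b) δ(b) = υ φ(υ).  If δ(b₁) = δ(b₂) = 1/γ,
-- then υ is at both points a solution of φ(γ) φ²(υ) + φ(υ) + γυ = 1, so w = υ(b₁ + b₂) solves
-- the homogeneous equation.  Hence γ w φ(w) = φ(D)² for some D ∈ b₁ + b₂ + 𝔽₂.  If w ≠ 0, put
-- p = D υ(b₁)/w and s = b₁ + p: on the one hand φ(s) + s = 1, on the other φ(s² + s) = 0, so
-- s ∈ 𝔽₂ and φ(s) + s = 0.  Therefore w = 0, that is, b₁ + b₂ ∈ 𝔽₂.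

open import Algebra.Apartness.Bundles using (HeytingCommutativeRing)
import Algebra.Apartness.Properties.HeytingCommutativeRing as HeytingProperties
open import Algebra.Bundles using (CommutativeRing; RawRing)
import Algebra.Properties.CommutativeMonoid.Sum as CommutativeMonoidSum
import Algebra.Properties.CommutativeSemiring.Exp as CommutativeSemiringExp
import Algebra.Properties.Monoid.Mult as MonoidMult
import Algebra.Properties.Ring as RingProperties
import Algebra.Properties.Semiring.Exp as SemiringExp
import Algebra.Properties.Semiring.Mult as SemiringMult
import Algebra.Solver.Ring as RingSolver
open import Algebra.Solver.Ring.AlmostCommutativeRing using (fromCommutativeRing; Induced-equivalence; _-Raw-AlmostCommutative⟶_)
open import Data.Bool.Base using (if_then_else_; true; false; Bool)
open import Data.Bool.Properties using (xor-∧-commutativeRing)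
open import Data.Fin.Base using (Fin; toℕ; zero; suc)
open import Data.Fin.Patterns using (0F; 1F; 2F)
open import Data.Fin.Permutation using (Permutation′; _⟨$⟩ʳ_; _⟨$⟩ˡ_; inverseʳ; inverseˡ; transpose; _∘ₚ_) renaming (_≈_ to _≈ₚ_; id to idₚ)
open import Data.Integer.Base as ℤ using (ℤ; 0ℤ; 1ℤ; -1ℤ)
import Data.Integer.Properties as ℤ
open import Data.Integer.Tactic.RingSolver using (solve-∀)
open import Data.List.Base using (List; []; _∷_; map; filter; foldr; length; _++_; cartesianProduct)
open import Data.List.Membership.Propositional using (_∈_; find)
open import Data.List.Membership.Propositional.Properties using (∈-tabulate⁺; ∈-filter⁺; ∈-filter⁻; ∈-map⁺; ∈-map⁻; ∈-deduplicate⁺; ∈-deduplicate⁻)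
open import Data.List.Membership.Propositional.Properties.WithK using (unique∧set⇒bag)
open import Data.List.Properties using (map-∘; length-tabulate; filter-≐)
open import Data.List.Relation.Binary.BagAndSetEquality using (∼bag⇒↭)
open import Data.List.Relation.Binary.Permutation.Propositional using (_↭_; ↭⇒↭ₛ)
import Data.List.Relation.Binary.Permutation.Propositional.Properties as Perm
open import Data.List.Relation.Binary.Permutation.Setoid.Properties using (foldr-commMonoid)
open import Data.List.Relation.Unary.All as All using ([]; _∷_)
open import Data.List.Relation.Unary.All.Properties using (¬All⇒Any¬)
open import Data.List.Relation.Unary.AllPairs using ([]; _∷_)
open import Data.List.Relation.Unary.Any using (here; there)
import Data.List.Relation.Unary.Unique.DecPropositional.Properties as DecUnique
open import Data.List.Relation.Unary.Unique.Propositional using (Unique)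
import Data.List.Relation.Unary.Unique.Propositional.Properties as Unique
open import Data.Maybe.Base using (just; nothing)
open import Data.Nat.Base as ℕ using (ℕ; zero; suc)
open import Data.Nat.GCD using (gcd; gcd-GCD; GCD; module Bézout)
import Data.Nat.Properties as ℕ
import Data.Nat.Tactic.RingSolver as ℕSolver
open import Data.Product.Base using (_×_; _,_; proj₁; proj₂; ∃-syntax; Σ-syntax)
open import Data.Rational.Base as ℚ using (ℚ; 0ℚ; 1ℚ)
import Data.Rational.Properties as ℚ
open import Data.Rational.Unnormalised.Base as ℚᵘ using (mkℚᵘ; *≡*)
import Data.Rational.Unnormalised.Properties as ℚᵘ
open import Data.Sum.Base using (_⊎_; inj₁; inj₂; [_,_]′)
open import Defs
open import Function.Base using (_∘_)
open import Function.Bundles using (mk⇔; Inverse; _⇔_)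
open import Relation.Binary.Definitions using (WeaklyDecidable)
open import Relation.Binary.PropositionalEquality
open import Relation.Nullary.Decidable using (does; Dec; dec-true; dec-false; yes; no; ¬?)
open import Relation.Nullary.Negation using (¬_; contradiction)
open import Relation.Unary using (Pred; Decidable)

open ≡-Reasoning
open import Algebra.Properties.Group ℚ.+-0-group using (identityʳ-unique)

-- The field is given only by its axioms and an enumeration, so the standard facts come from
-- counting: translations and scalings permute the list of elements, which yields characteristic two
-- and x^(2ⁿ) = x, and the trace, of degree 2ⁿ⁻¹, cannot vanish at all 2ⁿ points.
--
-- The obstacle in the two-to-one property is that the homogeneous equation for w can have nonzero
-- solutions for a given γ, so linear algebra alone does not finish. The quadratic relation γ υ φ(υ)
-- = φ(b)² + φ(b) must be used again, and it explains p. Put r = υ(b₁)/w. Because γ w φ(w) is the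
-- square φ(D)², the left side at b₁ factors as rφ(D) · φ(rD). Polarising the relation between b₁
-- and b₂ shows that these factors differ by 1. Hence p = rD satisfies the same relation φ(p)² +
-- φ(p) = γ υ(b₁) φ(υ(b₁)) as b₁, although υ(p) = υ(b₁) + 1.

module _ {a} {A : Set a} where

  -- The engine of the bijection arguments below: sums, products and lengths are invariant under
  -- permutation, so comparing members is enough.
  unique∧set⇒↭ : {xs ys : List A} → Unique xs → Unique ys →
                 (∀ {x} → x ∈ xs → x ∈ ys) → (∀ {x} → x ∈ ys → x ∈ xs) → xs ↭ ys
  unique∧set⇒↭ xs! ys! xs⊆ys ys⊆xs = ∼bag⇒↭ (unique∧set⇒bag xs! ys! (mk⇔ xs⊆ys ys⊆xs))

  ∑-cong : ∀ (xs : List A) {f g : A → ℤ} → (∀ {x} → x ∈ xs → f x ≡ g x) → ∑ xs f ≡ ∑ xs g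
  ∑-cong []       f≗g = refl
  ∑-cong (x ∷ xs) f≗g = cong₂ ℤ._+_ (f≗g (here refl)) (∑-cong xs (f≗g ∘ there))

  ∑-↭ : ∀ {xs ys : List A} (f : A → ℤ) → xs ↭ ys → ∑ xs f ≡ ∑ ys f
  ∑-↭ f xs↭ys = foldr-commMonoid (setoid ℤ) ℤ.+-0-isCommutativeMonoid (↭⇒↭ₛ (Perm.map⁺ f xs↭ys))

  ∑-map : ∀ (f : A → ℤ) (g : A → A) xs → ∑ (map g xs) f ≡ ∑ xs (f ∘ g)
  ∑-map f g xs = cong (foldr ℤ._+_ 0ℤ) (sym (map-∘ xs))

  *-distribˡ-∑ : ∀ c (xs : List A) f → c ℤ.* ∑ xs f ≡ ∑[ x ∈ xs ] (c ℤ.* f x)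
  *-distribˡ-∑ c []       f = ℤ.*-zeroʳ c
  *-distribˡ-∑ c (x ∷ xs) f =
    trans (ℤ.*-distribˡ-+ c (f x) (∑ xs f)) (cong (ℤ._+_ (c ℤ.* f x)) (*-distribˡ-∑ c xs f))

  *-distribʳ-∑ : ∀ c (xs : List A) f → ∑ xs f ℤ.* c ≡ ∑[ x ∈ xs ] (f x ℤ.* c)
  *-distribʳ-∑ c xs f = begin
    ∑ xs f ℤ.* c           ≡⟨ ℤ.*-comm (∑ xs f) c ⟩
    c ℤ.* ∑ xs f           ≡⟨ *-distribˡ-∑ c xs f ⟩
    ∑ xs (λ x → c ℤ.* f x) ≡⟨ ∑-cong xs (λ {x} _ → ℤ.*-comm c (f x)) ⟩
    ∑ xs (λ x → f x ℤ.* c) ∎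

  ∑-const : ∀ c (xs : List A) → ∑[ _ ∈ xs ] c ≡ ℤ.+ length xs ℤ.* c
  ∑-const c []       = refl
  ∑-const c (x ∷ xs) = trans (cong (ℤ._+_ c) (∑-const c xs)) (sym (ℤ.suc-* (ℤ.+ length xs) c))

  ∑-distrib-+ : ∀ (xs : List A) f g → ∑[ x ∈ xs ] (f x ℤ.+ g x) ≡ ∑ xs f ℤ.+ ∑ xs g
  ∑-distrib-+ []       f g = refl
  ∑-distrib-+ (x ∷ xs) f g = trans (cong (ℤ._+_ (f x ℤ.+ g x)) (∑-distrib-+ xs f g))
                                   (interchange (f x) (g x) (∑ xs f) (∑ xs g))
    where
    interchange : ∀ i j k l → i ℤ.+ j ℤ.+ (k ℤ.+ l) ≡ i ℤ.+ k ℤ.+ (j ℤ.+ l)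
    interchange = solve-∀

  ∑-++ : ∀ (xs ys : List A) f → ∑ (xs ++ ys) f ≡ ∑ xs f ℤ.+ ∑ ys f
  ∑-++ []       ys f = sym (ℤ.+-identityˡ _)
  ∑-++ (x ∷ xs) ys f = trans (cong (ℤ._+_ (f x)) (∑-++ xs ys f)) (sym (ℤ.+-assoc (f x) _ _))

𝟙 : ∀ {p} {P : Set p} → Dec P → ℤ
𝟙 P? = if does P? then 1ℤ else 0ℤ

𝟙-true : ∀ {p} {P : Set p} (P? : Dec P) → P → 𝟙 P? ≡ 1ℤ
𝟙-true P? p = cong (if_then 1ℤ else 0ℤ) (dec-true P? p)

𝟙-false : ∀ {p} {P : Set p} (P? : Dec P) → ¬ P → 𝟙 P? ≡ 0ℤ
𝟙-false P? ¬p = cong (if_then 1ℤ else 0ℤ) (dec-false P? ¬p)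

length-filter≡∑ : ∀ {a p} {A : Set a} {P : Pred A p} (P? : Decidable P) xs →
                  ℤ.+ length (filter P? xs) ≡ ∑[ x ∈ xs ] 𝟙 (P? x)
length-filter≡∑ P? [] = refl
length-filter≡∑ P? (x ∷ xs) with does (P? x)
... | true  = cong (ℤ._+_ 1ℤ) (length-filter≡∑ P? xs)
... | false = trans (length-filter≡∑ P? xs) (sym (ℤ.+-identityˡ _))

module _ {a b} {A : Set a} {B : Set b} where

  ∑-comm : ∀ (xs : List A) (ys : List B) (f : A → B → ℤ) →
           ∑[ x ∈ xs ] ∑[ y ∈ ys ] f x y ≡ ∑[ y ∈ ys ] ∑[ x ∈ xs ] f x y
  ∑-comm []       ys f = sym (trans (∑-const 0ℤ ys) (ℤ.*-zeroʳ (ℤ.+ length ys)))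
  ∑-comm (x ∷ xs) ys f =
    trans (cong (ℤ._+_ (∑ ys (f x))) (∑-comm xs ys f)) (sym (∑-distrib-+ ys (f x) _))

  ∑-cartesianProduct : ∀ (xs : List A) (ys : List B) (f : A × B → ℤ) →
                       ∑ (cartesianProduct xs ys) f ≡ ∑[ x ∈ xs ] ∑[ y ∈ ys ] f (x , y)
  ∑-cartesianProduct []       ys f = refl
  ∑-cartesianProduct (x ∷ xs) ys f = begin
    ∑ (map (x ,_) ys ++ cartesianProduct xs ys) f
      ≡⟨ ∑-++ (map (x ,_) ys) _ f ⟩
    ∑ (map (x ,_) ys) f ℤ.+ ∑ (cartesianProduct xs ys) f
      ≡⟨ cong₂ ℤ._+_ (cong (foldr ℤ._+_ 0ℤ) (sym (map-∘ ys))) (∑-cartesianProduct xs ys f) ⟩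
    ∑[ y ∈ ys ] f (x , y) ℤ.+ ∑[ x ∈ xs ] ∑[ y ∈ ys ] f (x , y) ∎

-- Finite fields: inverses, reindexing and the counting identities

module FiniteFieldProperties {c q} (𝔽 : FiniteField c q) where
  open FiniteField 𝔽 hiding (refl; sym; trans; reflexive; setoid)
  open CommutativeRing commutativeRing using (ring; semiring; *-monoid)
  open RingProperties ring using (-0#≈0#; +-cancelʳ; +-identityˡ-unique) public
  open MonoidMult (CommutativeRing.+-monoid commutativeRing) public using () renaming (_×_ to _·_)
  open SemiringMult semiring public using (×1-homo-*)

  private
    heytingCommutativeRing : HeytingCommutativeRing c c c
    heytingCommutativeRing = record { isHeytingCommutativeRing = isHeytingCommutativeRing }

  open HeytingProperties heytingCommutativeRing public using (1#0; x-0≈x)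

  ⁻¹-inverseʳ : ∀ {x} → x ≢ 0# → x * x ⁻¹ ≡ 1#
  ⁻¹-inverseʳ {x} x≢0 with x ≟ 0#
  ... | yes x≡0 = contradiction x≡0 x≢0
  ... | no  x≢0 = trans (cong (_* _) (sym (x-0≈x x))) (proj₂ (proj₂ (#⇒invertible x≢0)))

  ⁻¹-inverseˡ : ∀ {x} → x ≢ 0# → x ⁻¹ * x ≡ 1#
  ⁻¹-inverseˡ x≢0 = trans (*-comm _ _) (⁻¹-inverseʳ x≢0)

  x⁻¹*[x*y]≡y : ∀ {x} y → x ≢ 0# → x ⁻¹ * (x * y) ≡ y
  x⁻¹*[x*y]≡y y x≢0 =
    trans (sym (*-assoc _ _ y)) (trans (cong (_* y) (⁻¹-inverseˡ x≢0)) (*-identityˡ y))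

  x*[y/x]≡y : ∀ {x} y → x ≢ 0# → x * (y / x) ≡ y
  x*[y/x]≡y {x} y x≢0 = begin
    x * (y * x ⁻¹) ≡⟨ cong (x *_) (*-comm y _) ⟩
    x * (x ⁻¹ * y) ≡⟨ *-assoc x _ y ⟨
    x * x ⁻¹ * y   ≡⟨ cong (_* y) (⁻¹-inverseʳ x≢0) ⟩
    1# * y         ≡⟨ *-identityˡ y ⟩
    y              ∎

  *-cancelˡ-nonZero : ∀ {x y z} → x ≢ 0# → x * y ≡ x * z → y ≡ z
  *-cancelˡ-nonZero {x} {y} {z} x≢0 xy≡xz =
    trans (sym (x⁻¹*[x*y]≡y y x≢0)) (trans (cong (x ⁻¹ *_) xy≡xz) (x⁻¹*[x*y]≡y z x≢0))

  y≡x*z⇒y/x≡z : ∀ {x y z} → x ≢ 0# → y ≡ x * z → y / x ≡ z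
  y≡x*z⇒y/x≡z {y = y} x≢0 y≡xz = *-cancelˡ-nonZero x≢0 (trans (x*[y/x]≡y y x≢0) y≡xz)

  x*y≢0 : ∀ {x y} → x ≢ 0# → y ≢ 0# → x * y ≢ 0#
  x*y≢0 x≢0 y≢0 xy≡0 = y≢0 (*-cancelˡ-nonZero x≢0 (trans xy≡0 (sym (zeroʳ _))))

  x*y≡0⇒x≡0∨y≡0 : ∀ {x y} → x * y ≡ 0# → x ≡ 0# ⊎ y ≡ 0#
  x*y≡0⇒x≡0∨y≡0 {x} {y} xy≡0 with x ≟ 0#
  ... | yes x≡0 = inj₁ x≡0
  ... | no  x≢0 = inj₂ (*-cancelˡ-nonZero x≢0 (trans xy≡0 (sym (zeroʳ x))))

  ⁻¹-nonZero : ∀ {x} → x ≢ 0# → x ⁻¹ ≢ 0#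
  ⁻¹-nonZero {x} x≢0 x⁻¹≡0 =
    1#0 (trans (sym (⁻¹-inverseʳ x≢0)) (trans (cong (x *_) x⁻¹≡0) (zeroʳ x)))

  ∈-elements : ∀ x → x ∈ elements
  ∈-elements x =
    subst (_∈ elements) (Inverse.inverseˡ enumeration refl) (∈-tabulate⁺ (Inverse.from enumeration x))

  elements-! : Unique elements
  elements-! = Unique.tabulate⁺ (λ {i} {j} eq →
    trans (sym (Inverse.inverseʳ enumeration refl)) (Inverse.inverseʳ enumeration eq))

  length-elements : length elements ≡ q
  length-elements = length-tabulate (Inverse.to enumeration)

  map-↭ : ∀ (f g : Carrier → Carrier) → (∀ x → f (g x) ≡ x) → (∀ x → g (f x) ≡ x) →
          map f elements ↭ elements
  map-↭ f g f∘g g∘f = unique∧set⇒↭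
    (Unique.map⁺ (λ {x} {y} eq → trans (sym (g∘f x)) (trans (cong g eq) (g∘f y))) elements-!)
    elements-! (λ _ → ∈-elements _)
    (λ {x} _ → subst (_∈ map f elements) (f∘g x) (∈-map⁺ f (∈-elements (g x))))

  ∑-reindex : ∀ (h : Carrier → ℤ) (f g : Carrier → Carrier) → (∀ x → f (g x) ≡ x) →
              (∀ x → g (f x) ≡ x) → ∑ elements (λ x → h (f x)) ≡ ∑ elements h
  ∑-reindex h f g f∘g g∘f = trans (sym (∑-map h f elements)) (∑-↭ h (map-↭ f g f∘g g∘f))

  -- Written exactly like the summation list in `Z`, so that a sum over it becomes `Z` by
  -- computation.
  nonZeros : List Carrier
  nonZeros = filter (λ x → ¬? (x ≟ 0#)) elements

  ∈-nonZeros : ∀ {x} → x ≢ 0# → x ∈ nonZeros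
  ∈-nonZeros = ∈-filter⁺ (λ x → ¬? (x ≟ 0#)) (∈-elements _)

  nonZeros-≢0 : ∀ {x} → x ∈ nonZeros → x ≢ 0#
  nonZeros-≢0 x∈ = proj₂ (∈-filter⁻ (λ x → ¬? (x ≟ 0#)) {xs = elements} x∈)

  nonZeros-! : Unique nonZeros
  nonZeros-! = Unique.filter⁺ (λ x → ¬? (x ≟ 0#)) elements-!

  elements↭0∷nonZeros : elements ↭ 0# ∷ nonZeros
  elements↭0∷nonZeros = unique∧set⇒↭ elements-!
    (All.tabulate (λ x∈ → nonZeros-≢0 x∈ ∘ sym) ∷ nonZeros-!) to (λ _ → ∈-elements _)
    where
    to : ∀ {x} → x ∈ elements → x ∈ 0# ∷ nonZeros
    to {x} _ with x ≟ 0#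
    ... | yes x≡0 = here x≡0
    ... | no  x≢0 = there (∈-nonZeros x≢0)

  map-*-↭ : ∀ {a} → a ≢ 0# → map (a *_) nonZeros ↭ nonZeros
  map-*-↭ {a} a≢0 = unique∧set⇒↭
    (Unique.map⁺ (*-cancelˡ-nonZero a≢0) nonZeros-!) nonZeros-! to from
    where
    to : ∀ {x} → x ∈ map (a *_) nonZeros → x ∈ nonZeros
    to x∈ with ∈-map⁻ (a *_) x∈
    ... | y , y∈ , refl = ∈-nonZeros (x*y≢0 a≢0 (nonZeros-≢0 y∈))
    from : ∀ {x} → x ∈ nonZeros → x ∈ map (a *_) nonZeros
    from {x} x∈ = subst (_∈ map (a *_) nonZeros) (x*[y/x]≡y x a≢0)
      (∈-map⁺ (a *_) (∈-nonZeros (x*y≢0 (nonZeros-≢0 x∈) (⁻¹-nonZero a≢0))))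

  private
    ∏ : List Carrier → Carrier
    ∏ = foldr _*_ 1#

    ∏-map-* : ∀ a xs → ∏ (map (a *_) xs) ≡ a ^ length xs * ∏ xs
    ∏-map-* a []       = sym (*-identityˡ 1#)
    ∏-map-* a (x ∷ xs) = begin
      a * x * ∏ (map (a *_) xs)        ≡⟨ cong (a * x *_) (∏-map-* a xs) ⟩
      a * x * (a ^ length xs * ∏ xs)   ≡⟨ *-assoc a x _ ⟩
      a * (x * (a ^ length xs * ∏ xs)) ≡⟨ cong (a *_) (*-assoc x _ _) ⟨
      a * (x * a ^ length xs * ∏ xs)   ≡⟨ cong (λ y → a * (y * ∏ xs)) (*-comm x _) ⟩
      a * (a ^ length xs * x * ∏ xs)   ≡⟨ cong (a *_) (*-assoc _ x _) ⟩
      a * (a ^ length xs * (x * ∏ xs)) ≡⟨ *-assoc a _ _ ⟨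
      a * a ^ length xs * (x * ∏ xs)   ∎

    ∏-nonZero : ∀ xs → (∀ {x} → x ∈ xs → x ≢ 0#) → ∏ xs ≢ 0#
    ∏-nonZero []       _    = 1#0
    ∏-nonZero (x ∷ xs) xs≢0 = x*y≢0 (xs≢0 (here refl)) (∏-nonZero xs (xs≢0 ∘ there))

  -- Multiplication by x ≠ 0 permutes the nonzero elements, so their product P satisfies x^(q-1) P =
  -- P, and P ≠ 0 cancels. Rewriting q as one more than the length of `nonZeros` exposes the extra
  -- factor x, which covers x = 0.
  x^q≡x : ∀ x → x ^ q ≡ x
  x^q≡x x = trans (cong (x ^_) (trans (sym length-elements) (Perm.↭-length elements↭0∷nonZeros))) x^
    where
    x^ : x * x ^ length nonZeros ≡ x
    x^ with x ≟ 0#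
    ... | yes refl = zeroˡ _
    ... | no  x≢0  = trans (cong (x *_) x^[q-1]≡1) (*-identityʳ x)
      where
      x^[q-1]≡1 : x ^ length nonZeros ≡ 1#
      x^[q-1]≡1 = *-cancelˡ-nonZero (∏-nonZero nonZeros nonZeros-≢0) (begin
        ∏ nonZeros * x ^ length nonZeros ≡⟨ *-comm _ _ ⟩
        x ^ length nonZeros * ∏ nonZeros ≡⟨ ∏-map-* x nonZeros ⟨
        ∏ (map (x *_) nonZeros)
          ≡⟨ foldr-commMonoid (setoid Carrier) *-isCommutativeMonoid (↭⇒↭ₛ (map-*-↭ x≢0)) ⟩
        ∏ nonZeros                       ≡⟨ *-identityʳ _ ⟨
        ∏ nonZeros * 1#                  ∎)

  private
    ∑-map-1+ : ∀ xs → foldr _+_ 0# (map (1# +_) xs) ≡ length xs · 1# + foldr _+_ 0# xs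
    ∑-map-1+ []       = sym (+-identityˡ 0#)
    ∑-map-1+ (x ∷ xs) = begin
      1# + x + foldr _+_ 0# (map (1# +_) xs)         ≡⟨ cong (1# + x +_) (∑-map-1+ xs) ⟩
      1# + x + (length xs · 1# + foldr _+_ 0# xs)    ≡⟨ +-assoc 1# x _ ⟩
      1# + (x + (length xs · 1# + foldr _+_ 0# xs))  ≡⟨ cong (1# +_) (+-assoc x _ _) ⟨
      1# + (x + length xs · 1# + foldr _+_ 0# xs)
        ≡⟨ cong (λ y → 1# + (y + foldr _+_ 0# xs)) (+-comm x _) ⟩
      1# + (length xs · 1# + x + foldr _+_ 0# xs)    ≡⟨ cong (1# +_) (+-assoc _ x _) ⟩
      1# + (length xs · 1# + (x + foldr _+_ 0# xs))  ≡⟨ +-assoc 1# _ _ ⟨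
      1# + length xs · 1# + (x + foldr _+_ 0# xs)    ∎

  -- Adding 1 to every element permutes the field, so the sum of all elements stays the same
  -- although q ones were added.
  q·1≡0 : q · 1# ≡ 0#
  q·1≡0 = subst (λ m → m · 1# ≡ 0#) length-elements (+-identityˡ-unique _ _ (begin
    length elements · 1# + foldr _+_ 0# elements ≡⟨ ∑-map-1+ elements ⟨
    foldr _+_ 0# (map (1# +_) elements)
      ≡⟨ foldr-commMonoid (setoid Carrier) +-isCommutativeMonoid
           (↭⇒↭ₛ (map-↭ (1# +_) (- 1# +_) 1+[-1+x]≡x -1+[1+x]≡x)) ⟩
    foldr _+_ 0# elements ∎))
    where
    1+[-1+x]≡x : ∀ x → 1# + (- 1# + x) ≡ x
    1+[-1+x]≡x x = trans (sym (+-assoc _ _ x)) (trans (cong (_+ x) (-‿inverseʳ 1#)) (+-identityˡ x))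
    -1+[1+x]≡x : ∀ x → - 1# + (1# + x) ≡ x
    -1+[1+x]≡x x = trans (sym (+-assoc _ _ x)) (trans (cong (_+ x) (-‿inverseˡ 1#)) (+-identityˡ x))

-- Characteristic two and the Frobenius map

module BinaryFieldProperties {c n} (𝔽 : FiniteField c (2 ℕ.^ n)) where
  open FiniteField 𝔽 hiding (refl; sym; trans; reflexive; setoid)
  open FiniteFieldProperties 𝔽
  open CommutativeRing commutativeRing using (semiring; commutativeSemiring)
  open SemiringExp semiring using (^-assocʳ; ^-homo-*) public
  open CommutativeSemiringExp commutativeSemiring using (^-distrib-*) public

  -- A field has no zero divisors, so in 2ⁿ · 1 = 0 one factor 2 can be stripped at a time until one
  -- of them vanishes; stripping all of them would leave 1 = 0.
  1+1≡0 : 1# + 1# ≡ 0#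
  1+1≡0 = from2^·1≡0 n q·1≡0
    where
    from2^·1≡0 : ∀ m → (2 ℕ.^ m) · 1# ≡ 0# → 1# + 1# ≡ 0#
    from2^·1≡0 zero    eq = contradiction (trans (sym (+-identityʳ 1#)) eq) 1#0
    from2^·1≡0 (suc m) eq with x*y≡0⇒x≡0∨y≡0 (trans (sym (×1-homo-* 2 (2 ℕ.^ m))) eq)
    ... | inj₁ 2≡0 = trans (cong (1# +_) (sym (+-identityʳ 1#))) 2≡0
    ... | inj₂ 2^m≡0 = from2^·1≡0 m 2^m≡0

  private
    𝔽₂ : RawRing _ _
    𝔽₂ = CommutativeRing.rawRing xor-∧-commutativeRing

    ⟦_⟧₂ : Bool → Carrier
    ⟦ b ⟧₂ = if b then 1# else 0#

    -1≡1 : 1# ≡ - 1#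
    -1≡1 = begin
      1#                ≡⟨ +-identityʳ 1# ⟨
      1# + 0#           ≡⟨ cong (1# +_) (-‿inverseʳ 1#) ⟨
      1# + (1# + - 1#)  ≡⟨ +-assoc 1# 1# _ ⟨
      1# + 1# + - 1#    ≡⟨ cong (_+ - 1#) 1+1≡0 ⟩
      0# + - 1#         ≡⟨ +-identityˡ _ ⟩
      - 1#              ∎

    homomorphism : 𝔽₂ -Raw-AlmostCommutative⟶ fromCommutativeRing commutativeRing
    homomorphism = record
      { ⟦_⟧    = ⟦_⟧₂
      ; +-homo = λ { false b → sym (+-identityˡ _) ; true false → sym (+-identityʳ _) ; true true → sym 1+1≡0 }
      ; *-homo = λ { false b → sym (zeroˡ _) ; true b → sym (*-identityˡ _) }
      ; -‿homo = λ { false → sym -0#≈0# ; true → -1≡1 }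
      ; 0-homo = refl
      ; 1-homo = refl
      }

    _coefficient≟_ : WeaklyDecidable (Induced-equivalence homomorphism)
    false coefficient≟ false = just refl
    true  coefficient≟ true  = just refl
    _     coefficient≟ _     = nothing

  -- Coefficients in 𝔽₂ let the solver use 1 + 1 = 0.
  open RingSolver 𝔽₂ (fromCommutativeRing commutativeRing) homomorphism _coefficient≟_ public
    using (solve; con; _:+_; _:*_; _:=_)

  x+x≡0 : ∀ x → x + x ≡ 0#
  x+x≡0 = solve 1 (λ x → x :+ x := con false) refl

  x+y≡0⇒x≡y : ∀ {x y} → x + y ≡ 0# → x ≡ y
  x+y≡0⇒x≡y {x} {y} x+y≡0 = begin
    x           ≡⟨ solve 2 (λ x y → x := x :+ y :+ y) refl x y ⟩
    x + y + y   ≡⟨ cong (_+ y) x+y≡0 ⟩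
    0# + y      ≡⟨ +-identityˡ y ⟩
    y           ∎

  x²≡x⇒x≡0∨x≡1 : ∀ {x} → x * x ≡ x → x ≡ 0# ⊎ x ≡ 1#
  x²≡x⇒x≡0∨x≡1 {x} x²≡x with x ≟ 0#
  ... | yes x≡0 = inj₁ x≡0
  ... | no  x≢0 = inj₂ (*-cancelˡ-nonZero x≢0 (trans x²≡x (sym (*-identityʳ x))))

  x^2≡x*x : ∀ x → x ^ 2 ≡ x * x
  x^2≡x*x x = cong (x *_) (*-identityʳ x)

  ^2^suc : ∀ j x → x ^ (2 ℕ.^ suc j) ≡ (x * x) ^ (2 ℕ.^ j)
  ^2^suc j x = trans (sym (^-assocʳ x 2 (2 ℕ.^ j))) (cong (_^ (2 ℕ.^ j)) (x^2≡x*x x))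

  ^2^-distrib-+ : ∀ j x y → (x + y) ^ (2 ℕ.^ j) ≡ x ^ (2 ℕ.^ j) + y ^ (2 ℕ.^ j)
  ^2^-distrib-+ zero    x y = solve 2 (λ x y → (x :+ y) :* con true := x :* con true :+ y :* con true) refl x y
  ^2^-distrib-+ (suc j) x y = begin
    (x + y) ^ (2 ℕ.^ suc j)                     ≡⟨ ^2^suc j (x + y) ⟩
    ((x + y) * (x + y)) ^ (2 ℕ.^ j)
      ≡⟨ cong (_^ (2 ℕ.^ j)) (solve 2 (λ x y → (x :+ y) :* (x :+ y) := x :* x :+ y :* y) refl x y) ⟩
    (x * x + y * y) ^ (2 ℕ.^ j)                 ≡⟨ ^2^-distrib-+ j (x * x) (y * y) ⟩
    (x * x) ^ (2 ℕ.^ j) + (y * y) ^ (2 ℕ.^ j)   ≡⟨ cong₂ _+_ (^2^suc j x) (^2^suc j y) ⟨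
    x ^ (2 ℕ.^ suc j) + y ^ (2 ℕ.^ suc j)       ∎

  1^ : ∀ m → 1# ^ m ≡ 1#
  1^ zero    = refl
  1^ (suc m) = trans (*-identityˡ _) (1^ m)

  ^-nonZero : ∀ {x} m → x ≢ 0# → x ^ m ≢ 0#
  ^-nonZero zero    x≢0 = 1#0
  ^-nonZero (suc m) x≢0 = x*y≢0 x≢0 (^-nonZero m x≢0)

  x^m≡0⇒x≡0 : ∀ {x} m → x ^ m ≡ 0# → x ≡ 0#
  x^m≡0⇒x≡0 {x} m x^m≡0 with x ≟ 0#
  ... | yes x≡0 = x≡0
  ... | no  x≢0 = contradiction x^m≡0 (^-nonZero m x≢0)

  ^2^-iterate : ∀ {x} m → x ^ (2 ℕ.^ m) ≡ x → ∀ j → x ^ (2 ℕ.^ (j ℕ.* m)) ≡ x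
  ^2^-iterate {x} m fixed zero    = *-identityʳ x
  ^2^-iterate {x} m fixed (suc j) = begin
    x ^ (2 ℕ.^ (m ℕ.+ j ℕ.* m))           ≡⟨ cong (x ^_) (ℕ.^-distribˡ-+-* 2 m (j ℕ.* m)) ⟩
    x ^ (2 ℕ.^ m ℕ.* 2 ℕ.^ (j ℕ.* m))     ≡⟨ ^-assocʳ x (2 ℕ.^ m) _ ⟨
    (x ^ (2 ℕ.^ m)) ^ (2 ℕ.^ (j ℕ.* m))   ≡⟨ cong (_^ (2 ℕ.^ (j ℕ.* m))) fixed ⟩
    x ^ (2 ℕ.^ (j ℕ.* m))                 ≡⟨ ^2^-iterate m fixed j ⟩
    x                                     ∎

  -- This is where coprimality enters. The k-th and the n-th power of the Frobenius map both fix x,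
  -- hence so does the first, by Bézout. Over the naturals the identity has two forms, according to
  -- which multiple is the larger; x² is reached from the extra 1 in the exponent.
  coprime-fixed : ∀ k → gcd k n ≡ 1 → ∀ {x} → x ^ (2 ℕ.^ k) ≡ x → x * x ≡ x
  coprime-fixed k coprime {x} fixed with Bézout.identity (subst (GCD k n) coprime (gcd-GCD k n))
  ... | Bézout.+- a b 1+bn≡ak = begin
    x * x                             ≡⟨ ^2^-iterate n (x^q≡x (x * x)) b ⟨
    (x * x) ^ (2 ℕ.^ (b ℕ.* n))       ≡⟨ ^2^suc (b ℕ.* n) x ⟨
    x ^ (2 ℕ.^ suc (b ℕ.* n))         ≡⟨ cong (λ m → x ^ (2 ℕ.^ m)) 1+bn≡ak ⟩
    x ^ (2 ℕ.^ (a ℕ.* k))             ≡⟨ ^2^-iterate k fixed a ⟩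
    x                                 ∎
  ... | Bézout.-+ a b 1+ak≡bn = begin
    x * x                             ≡⟨ ^2^-iterate k fixed² a ⟨
    (x * x) ^ (2 ℕ.^ (a ℕ.* k))       ≡⟨ ^2^suc (a ℕ.* k) x ⟨
    x ^ (2 ℕ.^ suc (a ℕ.* k))         ≡⟨ cong (λ m → x ^ (2 ℕ.^ m)) 1+ak≡bn ⟩
    x ^ (2 ℕ.^ (b ℕ.* n))             ≡⟨ ^2^-iterate n (x^q≡x x) b ⟩
    x                                 ∎
    where
    fixed² : (x * x) ^ (2 ℕ.^ k) ≡ x * x
    fixed² = trans (^-distrib-* x x (2 ℕ.^ k)) (cong₂ _*_ fixed fixed)

-- The map δ is two-to-one

module KasamiIsAPN {c} (n k : ℕ) (coprime : gcd k n ≡ 1) (𝔽 : FiniteField c (2 ℕ.^ n)) where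
  open FiniteField 𝔽 hiding (refl; sym; trans; reflexive; setoid)
  open FiniteFieldProperties 𝔽
  open BinaryFieldProperties {n = n} 𝔽
  open Kasami n k 𝔽

  -- F(x) is the quotient of x^(q² + 1) by x^q; the multiplied form holds at 0 as well. Subtraction
  -- in the exponent is truncated, hence the check that q is at most 4ᵏ.
  x^q*Fx : ∀ x → x ^ (2 ℕ.^ k) * F x ≡ (x ^ (2 ℕ.^ k)) ^ (2 ℕ.^ k) * x
  x^q*Fx x = begin
    x ^ q * x ^ (4 ℕ.^ k ℕ.∸ q ℕ.+ 1)   ≡⟨ ^-homo-* x q _ ⟨
    x ^ (q ℕ.+ (4 ℕ.^ k ℕ.∸ q ℕ.+ 1))   ≡⟨ cong (x ^_) exponent ⟩
    x ^ (q ℕ.* q ℕ.+ 1)                 ≡⟨ ^-homo-* x (q ℕ.* q) 1 ⟩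
    x ^ (q ℕ.* q) * (x * 1#)            ≡⟨ cong₂ _*_ (sym (^-assocʳ x q q)) (*-identityʳ x) ⟩
    (x ^ q) ^ q * x                       ∎
    where
    q : ℕ
    q = 2 ℕ.^ k
    q≤4^k : q ℕ.≤ 4 ℕ.^ k
    q≤4^k = ℕ.^-monoˡ-≤ k (ℕ.s≤s (ℕ.s≤s ℕ.z≤n))
    4^k≡q*q : 4 ℕ.^ k ≡ q ℕ.* q
    4^k≡q*q = trans (ℕ.^-*-assoc 2 2 k) (trans (ℕ.^-distribˡ-+-* 2 k (k ℕ.+ 0))
      (cong (λ m → q ℕ.* 2 ℕ.^ m) (ℕ.+-identityʳ k)))
    exponent : q ℕ.+ (4 ℕ.^ k ℕ.∸ q ℕ.+ 1) ≡ q ℕ.* q ℕ.+ 1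
    exponent = trans (sym (ℕ.+-assoc q _ 1)) (cong (ℕ._+ 1)
      (trans (ℕ.m+[n∸m]≡n q≤4^k) 4^k≡q*q))

  -- Sealed, so that the rest of the argument rests on the six facts in the next block and never
  -- unfolds the power.
  opaque
    φ : Carrier → Carrier
    φ x = x ^ (2 ℕ.^ k)

  opaque
    unfolding φ

    φ-+ : ∀ x y → φ (x + y) ≡ φ x + φ y
    φ-+ = ^2^-distrib-+ k

    φ-* : ∀ x y → φ (x * y) ≡ φ x * φ y
    φ-* x y = ^-distrib-* x y (2 ℕ.^ k)

    φ-1 : φ 1# ≡ 1#
    φ-1 = 1^ (2 ℕ.^ k)

    φx≡0⇒x≡0 : ∀ {x} → φ x ≡ 0# → x ≡ 0#
    φx≡0⇒x≡0 = x^m≡0⇒x≡0 (2 ℕ.^ k)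

    φ-fixed⇒square : ∀ {x} → φ x ≡ x → x * x ≡ x
    φ-fixed⇒square = coprime-fixed k coprime

    φx*Fx : ∀ x → φ x * F x ≡ φ (φ x) * x
    φx*Fx = x^q*Fx

  φx≢0 : ∀ {x} → x ≢ 0# → φ x ≢ 0#
  φx≢0 x≢0 = x≢0 ∘ φx≡0⇒x≡0

  φ-fixed : ∀ {x} → φ x + x ≡ 0# → x ≡ 0# ⊎ x ≡ 1#
  φ-fixed φx+x≡0 = x²≡x⇒x≡0∨x≡1 (φ-fixed⇒square (x+y≡0⇒x≡y φx+x≡0))

  υ : Carrier → Carrier
  υ b = φ b + b

  υ-+ : ∀ x y → υ (x + y) ≡ υ x + υ y
  υ-+ x y = trans (cong (_+ (x + y)) (φ-+ x y))
    (solve 4 (λ a b x y → a :+ b :+ (x :+ y) := a :+ x :+ (b :+ y)) refl (φ x) (φ y) x y)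

  -- With q = 2ᵏ this reads δ(b) = υ(b)^(q+1) / (b² + b)^q.
  δ-formula : ∀ b → (φ b * φ b + φ b) * δ b ≡ υ b * φ (υ b)
  δ-formula b = begin
    (φ b * φ b + φ b) * (F b + F (b + 1#) + 1#)
      ≡⟨ solve 3 (λ B f g → (B :* B :+ B) :* (f :+ g :+ con true)
           := (B :+ con true) :* (B :* f) :+ B :* ((B :+ con true) :* g) :+ (B :* B :+ B))
           refl (φ b) (F b) (F (b + 1#)) ⟩
    (φ b + 1#) * (φ b * F b) + φ b * ((φ b + 1#) * F (b + 1#)) + (φ b * φ b + φ b)
      ≡⟨ cong₂ (λ x y → (φ b + 1#) * x + φ b * y + (φ b * φ b + φ b)) (φx*Fx b) [φb+1]*F[b+1] ⟩
    (φ b + 1#) * (φ (φ b) * b) + φ b * ((φ (φ b) + 1#) * (b + 1#)) + (φ b * φ b + φ b)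
      ≡⟨ solve 3 (λ b B C → (B :+ con true) :* (C :* b) :+ B :* ((C :+ con true) :* (b :+ con true))
                              :+ (B :* B :+ B) := (B :+ b) :* (C :+ B))
           refl b (φ b) (φ (φ b)) ⟩
    (φ b + b) * (φ (φ b) + φ b) ≡⟨ cong (υ b *_) (φ-+ (φ b) b) ⟨
    υ b * φ (υ b)               ∎
    where
    φ[b+1] : φ (b + 1#) ≡ φ b + 1#
    φ[b+1] = trans (φ-+ b 1#) (cong (φ b +_) φ-1)
    [φb+1]*F[b+1] : (φ b + 1#) * F (b + 1#) ≡ (φ (φ b) + 1#) * (b + 1#)
    [φb+1]*F[b+1] = begin
      (φ b + 1#) * F (b + 1#)      ≡⟨ cong (_* F (b + 1#)) φ[b+1] ⟨
      φ (b + 1#) * F (b + 1#)      ≡⟨ φx*Fx (b + 1#) ⟩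
      φ (φ (b + 1#)) * (b + 1#)    ≡⟨ cong (λ x → φ x * (b + 1#)) φ[b+1] ⟩
      φ (φ b + 1#) * (b + 1#)
        ≡⟨ cong (_* (b + 1#)) (trans (φ-+ (φ b) 1#) (cong (φ (φ b) +_) φ-1)) ⟩
      (φ (φ b) + 1#) * (b + 1#)    ∎

  F-0 : F 0# ≡ 0#
  F-0 = begin
    F 0#                            ≡⟨ ^-homo-* 0# (4 ℕ.^ k ℕ.∸ 2 ℕ.^ k) 1 ⟩
    0# ^ (4 ℕ.^ k ℕ.∸ 2 ℕ.^ k) * (0# * 1#) ≡⟨ cong (0# ^ (4 ℕ.^ k ℕ.∸ 2 ℕ.^ k) *_) (zeroˡ 1#) ⟩
    0# ^ (4 ℕ.^ k ℕ.∸ 2 ℕ.^ k) * 0#  ≡⟨ zeroʳ _ ⟩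
    0#                              ∎

  F-1 : F 1# ≡ 1#
  F-1 = 1^ (4 ℕ.^ k ℕ.∸ 2 ℕ.^ k ℕ.+ 1)

  δ-+1 : ∀ b → δ (b + 1#) ≡ δ b
  δ-+1 b = cong (_+ 1#) (trans
    (cong (λ x → F (b + 1#) + F x) (solve 1 (λ b → b :+ con true :+ con true := b) refl b))
    (+-comm _ _))

  δ-0 : δ 0# ≡ 0#
  δ-0 = begin
    F 0# + F (0# + 1#) + 1# ≡⟨ cong₂ (λ x y → x + F y + 1#) F-0 (+-identityˡ 1#) ⟩
    0# + F 1# + 1#          ≡⟨ cong (λ x → 0# + x + 1#) F-1 ⟩
    0# + 1# + 1#            ≡⟨ solve 0 (con false :+ con true :+ con true := con false) refl ⟩
    0#                      ∎

  δ-1 : δ 1# ≡ 0#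
  δ-1 = trans (cong δ (sym (+-identityˡ 1#))) (trans (δ-+1 0#) δ-0)

  δ≡0⇒υ≡0 : ∀ {b} → δ b ≡ 0# → υ b ≡ 0#
  δ≡0⇒υ≡0 {b} δb≡0 = [ (λ υb≡0 → υb≡0) , φx≡0⇒x≡0 ]′ (x*y≡0⇒x≡0∨y≡0 (begin
    υ b * φ (υ b)                  ≡⟨ δ-formula b ⟨
    (φ b * φ b + φ b) * δ b        ≡⟨ cong ((φ b * φ b + φ b) *_) δb≡0 ⟩
    (φ b * φ b + φ b) * 0#         ≡⟨ zeroʳ _ ⟩
    0#                             ∎))

  -- `δ-formula` is silent here, because its factor φ(b)² + φ(b) vanishes too. Instead, υ(b) = 0
  -- leaves only b = 0 and b = 1.
  υ≡0⇒δ≡0 : ∀ {b} → υ b ≡ 0# → δ b ≡ 0#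
  υ≡0⇒δ≡0 {b} υb≡0 =
    [ (λ b≡0 → trans (cong δ b≡0) δ-0) , (λ b≡1 → trans (cong δ b≡1) δ-1) ]′ (φ-fixed υb≡0)

  module _ {γ b : Carrier} (υb≢0 : υ b ≢ 0#) (γ*δb≡1 : γ * δ b ≡ 1#) where

    -- An Artin-Schreier equation for φ(b), obtained from `δ-formula` by multiplying with the
    -- inverse of δ(b).
    γυφυ : γ * υ b * φ (υ b) ≡ φ b * φ b + φ b
    γυφυ = begin
      γ * υ b * φ (υ b)                    ≡⟨ *-assoc γ _ _ ⟩
      γ * (υ b * φ (υ b))                  ≡⟨ cong (γ *_) (δ-formula b) ⟨
      γ * ((φ b * φ b + φ b) * δ b)        ≡⟨ solve 3 (λ x y z → x :* (y :* z) := y :* (x :* z)) refl γ _ (δ b) ⟩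
      (φ b * φ b + φ b) * (γ * δ b)        ≡⟨ cong ((φ b * φ b + φ b) *_) γ*δb≡1 ⟩
      (φ b * φ b + φ b) * 1#               ≡⟨ *-identityʳ _ ⟩
      φ b * φ b + φ b                      ∎

    -- The sum of γυφυ and its image under φ, divided by φ(υ b).
    υ-affine : φ γ * φ (φ (υ b)) + γ * υ b ≡ φ (υ b) + 1#
    υ-affine = *-cancelˡ-nonZero (φx≢0 υb≢0) (begin
      φ (υ b) * (φ γ * φ (φ (υ b)) + γ * υ b)
        ≡⟨ solve 5 (λ u v w g h → v :* (h :* w :+ g :* u) := h :* v :* w :+ g :* u :* v)
             refl (υ b) (φ (υ b)) (φ (φ (υ b))) γ (φ γ) ⟩
      φ γ * φ (υ b) * φ (φ (υ b)) + γ * υ b * φ (υ b)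
        ≡⟨ cong₂ _+_ (trans (cong (_* φ (φ (υ b))) (sym (φ-* γ (υ b)))) (sym (φ-* _ _))) γυφυ ⟩
      φ (γ * υ b * φ (υ b)) + (φ b * φ b + φ b)
        ≡⟨ cong (λ x → φ x + (φ b * φ b + φ b)) γυφυ ⟩
      φ (φ b * φ b + φ b) + (φ b * φ b + φ b)
        ≡⟨ cong (_+ (φ b * φ b + φ b)) (trans (φ-+ _ _) (cong (_+ φ (φ b)) (φ-* _ _))) ⟩
      φ (φ b) * φ (φ b) + φ (φ b) + (φ b * φ b + φ b)
        ≡⟨ solve 2 (λ B C → C :* C :+ C :+ (B :* B :+ B) := (C :+ B) :* ((C :+ B) :+ con true))
             refl (φ b) (φ (φ b)) ⟩
      (φ (φ b) + φ b) * (φ (φ b) + φ b + 1#)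
        ≡⟨ cong (λ x → x * (x + 1#)) (φ-+ (φ b) b) ⟨
      φ (υ b) * (φ (υ b) + 1#)             ∎)

  module _ {γ b₁ b₂ : Carrier} (υb₁≢0 : υ b₁ ≢ 0#) (υb₂≢0 : υ b₂ ≢ 0#)
           (γ*δb₁≡1 : γ * δ b₁ ≡ 1#) (γ*δb₂≡1 : γ * δ b₂ ≡ 1#) where

    private
      -- ε is the defect of E from the square φ(d)². It turns out to lie in 𝔽₂, so replacing d by D
      -- absorbs it without changing υ.
      d u w E ε D : Carrier
      d = b₁ + b₂
      u = υ b₁
      w = υ d
      E = γ * w * φ w
      ε = E + φ d * φ d
      D = d + ε

      φw : φ w ≡ φ (φ d) + φ d
      φw = φ-+ (φ d) d

      w-linear : φ γ * φ (φ w) + γ * w ≡ φ w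
      w-linear = begin
        φ γ * φ (φ w) + γ * w
          ≡⟨ cong₂ (λ x y → φ γ * x + γ * y) (trans (cong φ φw₁₂) (φ-+ _ _)) (υ-+ b₁ b₂) ⟩
        φ γ * (φ (φ (υ b₁)) + φ (φ (υ b₂))) + γ * (υ b₁ + υ b₂)
          ≡⟨ solve 6 (λ g h x y z t → h :* (x :+ y) :+ g :* (z :+ t) := h :* x :+ g :* z :+ (h :* y :+ g :* t))
               refl γ (φ γ) (φ (φ (υ b₁))) (φ (φ (υ b₂))) (υ b₁) (υ b₂) ⟩
        φ γ * φ (φ (υ b₁)) + γ * υ b₁ + (φ γ * φ (φ (υ b₂)) + γ * υ b₂)
          ≡⟨ cong₂ _+_ (υ-affine υb₁≢0 γ*δb₁≡1) (υ-affine υb₂≢0 γ*δb₂≡1) ⟩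
        φ (υ b₁) + 1# + (φ (υ b₂) + 1#)
          ≡⟨ solve 2 (λ x y → x :+ con true :+ (y :+ con true) := x :+ y) refl _ _ ⟩
        φ (υ b₁) + φ (υ b₂) ≡⟨ φw₁₂ ⟨
        φ w                 ∎
        where
        φw₁₂ : φ w ≡ φ (υ b₁) + φ (υ b₂)
        φw₁₂ = trans (cong φ (υ-+ b₁ b₂)) (φ-+ _ _)

      -- Multiplying `w-linear` by φ(w) gives φ(E) + E = φ(w)². Since φ(w) = φ²(d) + φ(d), the
      -- summand φ(d)² of ε contributes the same amount, and the two cancel.
      φε+ε≡0 : φ ε + ε ≡ 0#
      φε+ε≡0 = begin
        φ ε + ε
          ≡⟨ cong (_+ ε) (trans (φ-+ _ _) (cong₂ _+_ (trans (φ-* _ _) (cong (_* φ (φ w)) (φ-* _ _))) (φ-* _ _))) ⟩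
        φ γ * φ w * φ (φ w) + φ (φ d) * φ (φ d) + (γ * w * φ w + φ d * φ d)
          ≡⟨ solve 7 (λ g h w v x d e → h :* v :* x :+ e :* e :+ (g :* w :* v :+ d :* d)
                        := v :* (h :* x :+ g :* w) :+ (e :+ d) :* (e :+ d))
               refl γ (φ γ) w (φ w) (φ (φ w)) (φ d) (φ (φ d)) ⟩
        φ w * (φ γ * φ (φ w) + γ * w) + (φ (φ d) + φ d) * (φ (φ d) + φ d)
          ≡⟨ cong₂ (λ x y → φ w * x + y * y) w-linear (sym φw) ⟩
        φ w * φ w + φ w * φ w ≡⟨ x+x≡0 _ ⟩
        0#                    ∎

      φε≡ε : φ ε ≡ ε
      φε≡ε = x+y≡0⇒x≡y φε+ε≡0

      ε²≡ε : ε * ε ≡ ε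
      ε²≡ε = φ-fixed⇒square φε≡ε

      φD : φ D ≡ φ d + ε
      φD = trans (φ-+ d ε) (cong (φ d +_) φε≡ε)

      -- Because ε² = ε, a shift by ε survives squaring, and ε is exactly what separates φ(d)² from
      -- E.
      φD² : φ D * φ D ≡ E
      φD² = begin
        φ D * φ D             ≡⟨ cong (λ x → x * x) φD ⟩
        (φ d + ε) * (φ d + ε) ≡⟨ solve 2 (λ x y → (x :+ y) :* (x :+ y) := x :* x :+ y :* y) refl (φ d) ε ⟩
        φ d * φ d + ε * ε     ≡⟨ cong (φ d * φ d +_) ε²≡ε ⟩
        φ d * φ d + ε         ≡⟨ solve 2 (λ x y → x :+ (y :+ x) := y) refl (φ d * φ d) E ⟩
        E                     ∎

      υD : φ D + D ≡ w
      υD = trans (cong (_+ D) φD) (solve 3 (λ x y z → x :+ z :+ (y :+ z) := x :+ y) refl (φ d) d ε)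

      υb₂ : υ b₂ ≡ u + w
      υb₂ = trans (solve 2 (λ x y → y := x :+ (x :+ y)) refl u (υ b₂)) (cong (u +_) (sym (υ-+ b₁ b₂)))

      -- Polarisation of the form x ↦ γ x φ(x) at u and w. Its values at u and u + w = υ(b₂) are
      -- given by `γυφυ`, and its value at w is E.
      bilinear : γ * (u * φ w + w * φ u) ≡ φ D
      bilinear = begin
        γ * (u * φ w + w * φ u)
          ≡⟨ solve 5 (λ g u v w x → g :* (u :* x :+ w :* v)
               := g :* u :* v :+ g :* (u :+ w) :* (v :+ x) :+ g :* w :* x)
               refl γ u (φ u) w (φ w) ⟩
        γ * u * φ u + γ * (u + w) * (φ u + φ w) + E
          ≡⟨ cong (λ x → γ * u * φ u + γ * (u + w) * x + E) (φ-+ u w) ⟨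
        γ * u * φ u + γ * (u + w) * φ (u + w) + E
          ≡⟨ cong (λ x → γ * u * φ u + γ * x * φ x + E) υb₂ ⟨
        γ * u * φ u + γ * υ b₂ * φ (υ b₂) + E
          ≡⟨ cong₂ (λ x y → x + y + E) (γυφυ υb₁≢0 γ*δb₁≡1) (γυφυ υb₂≢0 γ*δb₂≡1) ⟩
        φ b₁ * φ b₁ + φ b₁ + (φ b₂ * φ b₂ + φ b₂) + E
          ≡⟨ solve 3 (λ x y e → x :* x :+ x :+ (y :* y :+ y) :+ e := (x :+ y) :+ (e :+ (x :+ y) :* (x :+ y)))
               refl (φ b₁) (φ b₂) E ⟩
        φ b₁ + φ b₂ + (E + (φ b₁ + φ b₂) * (φ b₁ + φ b₂))
          ≡⟨ cong (λ x → x + (E + x * x)) (φ-+ b₁ b₂) ⟨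
        φ d + ε ≡⟨ φD ⟨
        φ D     ∎

      w≢0⇒⊥ : w ≢ 0# → 1# ≡ 0#
      w≢0⇒⊥ w≢0 = trans (sym υs≡1) υs≡0
        where
        wφw≢0 : w * φ w ≢ 0#
        wφw≢0 = x*y≢0 w≢0 (φx≢0 w≢0)

        E≢0 : E ≢ 0#
        E≢0 E≡0 = wφw≢0 (begin
          w * φ w                ≡⟨ *-identityˡ _ ⟨
          1# * (w * φ w)         ≡⟨ cong (_* (w * φ w)) γ*δb₁≡1 ⟨
          γ * δ b₁ * (w * φ w)   ≡⟨ solve 4 (λ g x w v → g :* x :* (w :* v) := x :* (g :* w :* v)) refl γ (δ b₁) w (φ w) ⟩
          δ b₁ * E               ≡⟨ cong (δ b₁ *_) E≡0 ⟩
          δ b₁ * 0#              ≡⟨ zeroʳ _ ⟩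
          0#                     ∎)

        φD≢0 : φ D ≢ 0#
        φD≢0 φD≡0 = E≢0 (trans (sym φD²) (trans (cong (_* φ D) φD≡0) (zeroˡ _)))

        -- In γ u φ(u) = φ(D)² r φ(r), one of the two natural factors is φ(r) φ(D) = φ(rD); p is
        -- chosen so that φ(p) is this factor.
        r p s : Carrier
        r = u / w
        p = r * D
        s = b₁ + p

        u≡wr : u ≡ w * r
        u≡wr = sym (x*[y/x]≡y u w≢0)

        φu≡φwφr : φ u ≡ φ w * φ r
        φu≡φwφr = trans (cong φ u≡wr) (φ-* w r)

        -- Divide `bilinear` by w φ(w) and replace γ by φ(D)²/(w φ(w)); one factor φ(D) cancels.
        -- This says that the two factors rφ(D) and φ(r)φ(D) differ by 1.
        φD[r+φr]≡1 : φ D * (r + φ r) ≡ 1#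
        φD[r+φr]≡1 = *-cancelˡ-nonZero (x*y≢0 φD≢0 wφw≢0) (begin
          φ D * (w * φ w) * (φ D * (r + φ r))
            ≡⟨ solve 5 (λ D w v r t → D :* (w :* v) :* (D :* (r :+ t))
                 := D :* D :* (w :* r :* v :+ w :* (v :* t)))
                 refl (φ D) w (φ w) r (φ r) ⟩
          φ D * φ D * (w * r * φ w + w * (φ w * φ r))
            ≡⟨ cong₂ (λ x y → φ D * φ D * (x * φ w + w * y)) u≡wr φu≡φwφr ⟨
          φ D * φ D * (u * φ w + w * φ u)
            ≡⟨ cong (_* (u * φ w + w * φ u)) φD² ⟩
          γ * w * φ w * (u * φ w + w * φ u)
            ≡⟨ solve 4 (λ g w v x → g :* w :* v :* x := g :* x :* (w :* v)) refl γ w (φ w) _ ⟩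
          γ * (u * φ w + w * φ u) * (w * φ w)
            ≡⟨ cong (_* (w * φ w)) bilinear ⟩
          φ D * (w * φ w)      ≡⟨ *-identityʳ _ ⟨
          φ D * (w * φ w) * 1# ∎)

        φp : φ p ≡ r * φ D + 1#
        φp = begin
          φ p                                ≡⟨ φ-* r D ⟩
          φ r * φ D                          ≡⟨ solve 3 (λ r t x → t :* x := r :* x :+ x :* (r :+ t)) refl r (φ r) (φ D) ⟩
          r * φ D + φ D * (r + φ r)          ≡⟨ cong (r * φ D +_) φD[r+φr]≡1 ⟩
          r * φ D + 1#                       ∎

        -- By `φp`, υ(p) = r(φ(D) + D) + 1 = rw + 1 = u + 1, while υ(b₁) = u.
        υs≡1 : υ s ≡ 1#
        υs≡1 = begin
          υ s                              ≡⟨ υ-+ b₁ p ⟩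
          u + (φ p + p)                    ≡⟨ cong₂ (λ x y → x + (y + p)) (trans u≡wr (cong (_* r) (sym υD))) φp ⟩
          (φ D + D) * r + (r * φ D + 1# + r * D)
            ≡⟨ solve 3 (λ x y r → (x :+ y) :* r :+ (r :* x :+ con true :+ r :* y) := con true) refl (φ D) D r ⟩
          1#                               ∎

        rφD : r * φ D ≡ φ p + 1#
        rφD = trans (solve 1 (λ x → x := x :+ con true :+ con true) refl (r * φ D)) (cong (_+ 1#) (sym φp))

        φb²+φb : φ b₁ * φ b₁ + φ b₁ ≡ φ p * φ p + φ p
        φb²+φb = begin
          φ b₁ * φ b₁ + φ b₁                 ≡⟨ γυφυ υb₁≢0 γ*δb₁≡1 ⟨
          γ * u * φ u                        ≡⟨ cong₂ (λ x y → γ * x * y) u≡wr φu≡φwφr ⟩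
          γ * (w * r) * (φ w * φ r)          ≡⟨ solve 5 (λ g w r v t → g :* (w :* r) :* (v :* t) := g :* w :* v :* (r :* t)) refl γ w r (φ w) (φ r) ⟩
          E * (r * φ r)                      ≡⟨ cong (_* (r * φ r)) φD² ⟨
          φ D * φ D * (r * φ r)              ≡⟨ solve 3 (λ x r t → x :* x :* (r :* t) := (r :* x) :* (t :* x)) refl (φ D) r (φ r) ⟩
          (r * φ D) * (φ r * φ D)            ≡⟨ cong₂ _*_ rφD (sym (φ-* r D)) ⟩
          (φ p + 1#) * φ p                   ≡⟨ solve 1 (λ x → (x :+ con true) :* x := x :* x :+ x) refl (φ p) ⟩
          φ p * φ p + φ p                    ∎

        φs²+φs≡0 : φ s * φ s + φ s ≡ 0#
        φs²+φs≡0 = begin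
          φ s * φ s + φ s ≡⟨ cong (λ x → x * x + x) (φ-+ b₁ p) ⟩
          (φ b₁ + φ p) * (φ b₁ + φ p) + (φ b₁ + φ p)
            ≡⟨ solve 2 (λ x y → (x :+ y) :* (x :+ y) :+ (x :+ y) := (x :* x :+ x) :+ (y :* y :+ y)) refl (φ b₁) (φ p) ⟩
          (φ b₁ * φ b₁ + φ b₁) + (φ p * φ p + φ p) ≡⟨ cong (_+ (φ p * φ p + φ p)) φb²+φb ⟩
          (φ p * φ p + φ p) + (φ p * φ p + φ p) ≡⟨ x+x≡0 _ ⟩
          0# ∎

        υs≡0 : υ s ≡ 0#
        υs≡0 = [ (λ φs≡0 → trans (cong₂ _+_ φs≡0 (φx≡0⇒x≡0 φs≡0)) (+-identityˡ 0#))
               , (λ φs≡1 → trans (cong₂ _+_ φs≡1 (s≡1 φs≡1)) (x+x≡0 1#))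
               ]′ (x²≡x⇒x≡0∨x≡1 (x+y≡0⇒x≡y φs²+φs≡0))
          where
          s≡1 : φ s ≡ 1# → s ≡ 1#
          s≡1 φs≡1 = x+y≡0⇒x≡y (φx≡0⇒x≡0 (begin
            φ (s + 1#)   ≡⟨ φ-+ s 1# ⟩
            φ s + φ 1#   ≡⟨ cong₂ _+_ φs≡1 φ-1 ⟩
            1# + 1#      ≡⟨ 1+1≡0 ⟩
            0#           ∎))

    υ[b₁+b₂]≡0 : υ d ≡ 0#
    υ[b₁+b₂]≡0 with w ≟ 0#
    ... | yes w≡0 = w≡0
    ... | no  w≢0 = contradiction (w≢0⇒⊥ w≢0) 1#0

  -- The inverse γ exists only when the common value is nonzero; for the value 0, υ vanishes at both
  -- points and additivity suffices.
  δb₁≡δb₂⇒υ≡0 : ∀ {b₁ b₂} → δ b₁ ≡ δ b₂ → υ (b₁ + b₂) ≡ 0#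
  δb₁≡δb₂⇒υ≡0 {b₁} {b₂} δb₁≡δb₂ with δ b₁ ≟ 0#
  ... | yes δb₁≡0 = trans (υ-+ b₁ b₂) (trans
        (cong₂ _+_ (δ≡0⇒υ≡0 δb₁≡0) (δ≡0⇒υ≡0 (trans (sym δb₁≡δb₂) δb₁≡0))) (+-identityˡ 0#))
  ... | no  δb₁≢0 = υ[b₁+b₂]≡0 (δb₁≢0 ∘ υ≡0⇒δ≡0)
        (λ υb₂≡0 → δb₁≢0 (trans δb₁≡δb₂ (υ≡0⇒δ≡0 υb₂≡0)))
        (⁻¹-inverseˡ δb₁≢0) (trans (cong (δ b₁ ⁻¹ *_) (sym δb₁≡δb₂)) (⁻¹-inverseˡ δb₁≢0))

  δ-two-to-one : ∀ {b₁ b₂} → δ b₁ ≡ δ b₂ → b₂ ≡ b₁ ⊎ b₂ ≡ b₁ + 1#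
  δ-two-to-one {b₁} {b₂} δb₁≡δb₂ =
    [ (λ d≡0 → inj₁ (sym (x+y≡0⇒x≡y d≡0)))
    , (λ d≡1 → inj₂ (trans (solve 2 (λ x y → y := x :+ (x :+ y)) refl b₁ b₂) (cong (b₁ +_) d≡1)))
    ]′ (φ-fixed (δb₁≡δb₂⇒υ≡0 δb₁≡δb₂))

-- Polynomial functions and their roots

module BinaryPolynomials {c n} (𝔽 : FiniteField c (2 ℕ.^ n)) where
  open FiniteField 𝔽 hiding (refl; sym; trans; reflexive; setoid)
  open FiniteFieldProperties 𝔽
  open BinaryFieldProperties {n = n} 𝔽

  -- f is a polynomial function of degree at most d whose coefficient in degree d is a,
  -- expressed by iterated divided differences; x + y is x - y in characteristic 2.
  Degree : ℕ → (Carrier → Carrier) → Carrier → Set c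
  Degree zero    f a = ∀ x → f x ≡ a
  Degree (suc d) f a = ∀ y → ∃[ g ] Degree d g a × (∀ x → f x ≡ f y + (x + y) * g x)

  -- Factor theorem: dividing by x + y at a root y keeps the leading coefficient a, and the quotient
  -- inherits the remaining roots. In degree 0 the function is the nonzero constant a.
  length-roots : ∀ d {f a xs} → Degree d f a → a ≢ 0# → Unique xs →
                 (∀ {x} → x ∈ xs → f x ≡ 0#) → length xs ℕ.≤ d
  length-roots d       {xs = []}     _ _   _ _     = ℕ.z≤n
  length-roots zero    {xs = x ∷ _}  F a≢0 _ roots =
    contradiction (trans (sym (F x)) (roots (here refl))) a≢0
  length-roots (suc d) {f} {xs = y ∷ xs} F a≢0 (y∉xs ∷ xs!) roots with F y
  ... | g , G , f≡ = ℕ.s≤s (length-roots d G a≢0 xs! g-roots)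
    where
    g-roots : ∀ {x} → x ∈ xs → g x ≡ 0#
    g-roots {x} x∈ = [ (λ x+y≡0 → contradiction (sym (x+y≡0⇒x≡y x+y≡0)) (All.lookup y∉xs x∈))
                     , (λ gx≡0 → gx≡0) ]′ (x*y≡0⇒x≡0∨y≡0 (begin
      (x + y) * g x         ≡⟨ +-identityˡ _ ⟨
      0# + (x + y) * g x    ≡⟨ cong (_+ (x + y) * g x) (roots (here refl)) ⟨
      f y + (x + y) * g x   ≡⟨ f≡ x ⟨
      f x                   ≡⟨ roots (there x∈) ⟩
      0#                    ∎))

  Degree-cong : ∀ d {f g a} → (∀ x → f x ≡ g x) → Degree d f a → Degree d g a
  Degree-cong zero    f≗g F x = trans (sym (f≗g x)) (F x)
  Degree-cong (suc d) f≗g F y with F y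
  ... | h , H , f≡ = h , H , λ x →
    trans (sym (f≗g x)) (trans (f≡ x) (cong (_+ (x + y) * h x) (f≗g y)))

  Degree-+ : ∀ d {f g a b} → Degree d f a → Degree d g b → Degree d (λ x → f x + g x) (a + b)
  Degree-+ zero    F G x = cong₂ _+_ (F x) (G x)
  Degree-+ (suc d) {f} {g} F G y with F y | G y
  ... | f′ , F′ , f≡ | g′ , G′ , g≡ = _ , Degree-+ d F′ G′ , λ x → trans (cong₂ _+_ (f≡ x) (g≡ x))
    (solve 5 (λ a b t s r → a :+ t :* s :+ (b :+ t :* r) := a :+ b :+ t :* (s :+ r))
       refl (f y) (g y) (x + y) (f′ x) (g′ x))

  Degree-scale : ∀ d {f a} b → Degree d f a → Degree d (λ x → b * f x) (b * a)
  Degree-scale zero    b F x = cong (b *_) (F x)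
  Degree-scale (suc d) {f} b F y with F y
  ... | g , G , f≡ = _ , Degree-scale d b G , λ x → trans (cong (b *_) (f≡ x))
    (solve 4 (λ b u t s → b :* (u :+ t :* s) := b :* u :+ t :* (b :* s)) refl b (f y) (x + y) (g x))

  Degree-suc : ∀ d {f a} → Degree d f a → Degree (suc d) f 0#
  Degree-suc zero    {f} F y = (λ _ → 0#) , (λ _ → refl) , λ x →
    trans (F x) (trans (sym (F y)) (sym (trans (cong (f y +_) (zeroʳ _)) (+-identityʳ _))))
  Degree-suc (suc d) F y with F y
  ... | g , G , f≡ = g , Degree-suc d G , f≡

  Degree-<′ : ∀ {d e f a} → d ℕ.<′ e → Degree d f a → Degree e f 0#
  Degree-<′ ℕ.≤′-refl       F = Degree-suc _ F
  Degree-<′ (ℕ.≤′-step d<e) F = Degree-suc _ (Degree-<′ d<e F)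

  -- The divided difference of x f(x) at y is f(x) + y g(x), where g is that of f. The second
  -- summand has lower degree, so the leading coefficient is that of f.
  Degree-x* : ∀ d {f a} → Degree d f a → Degree (suc d) (λ x → x * f x) a
  Degree-x* zero    {f} {a} F y = f , F , λ x → begin
    x * f x                   ≡⟨ cong (x *_) (F x) ⟩
    x * a                     ≡⟨ solve 3 (λ x y a → x :* a := y :* a :+ (x :+ y) :* a) refl x y a ⟩
    y * a + (x + y) * a       ≡⟨ cong₂ (λ s t → y * s + (x + y) * t) (F y) (F x) ⟨
    y * f y + (x + y) * f x   ∎
  Degree-x* (suc d) {f} {a} F y with F y
  ... | g , G , f≡ = _ ,
    subst (Degree (suc d) _) (+-identityʳ a) (Degree-+ (suc d) F (Degree-suc d (Degree-scale d y G))) ,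
    λ x → begin
    x * f x
      ≡⟨ solve 4 (λ x y u v → x :* u := y :* v :+ (x :+ y) :* u :+ y :* (u :+ v)) refl x y (f x) (f y) ⟩
    y * f y + (x + y) * f x + y * (f x + f y)
      ≡⟨ cong (λ s → y * f y + (x + y) * f x + y * (s + f y)) (f≡ x) ⟩
    y * f y + (x + y) * f x + y * (f y + (x + y) * g x + f y)
      ≡⟨ solve 5 (λ x y u v s → y :* v :+ (x :+ y) :* u :+ y :* (v :+ (x :+ y) :* s :+ v)
                                := y :* v :+ (x :+ y) :* (u :+ y :* s)) refl x y (f x) (f y) (g x) ⟩
    y * f y + (x + y) * (f x + y * g x) ∎

  Degree-^ : ∀ d → Degree d (_^ d) 1#
  Degree-^ zero    = λ _ → refl
  Degree-^ (suc d) = Degree-x* d (Degree-^ d)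

-- The trace and its additive character

module AdditiveCharacter {c} (n k : ℕ) (𝔽 : FiniteField c (2 ℕ.^ n)) where
  open FiniteField 𝔽 hiding (refl; sym; trans; reflexive; setoid)
  open FiniteFieldProperties 𝔽
  open BinaryFieldProperties {n = n} 𝔽
  open BinaryPolynomials {n = n} 𝔽
  open CommutativeMonoidSum (CommutativeRing.+-commutativeMonoid commutativeRing)
    using (sum-cong-≗) renaming (∑-distrib-+ to sum-distrib-+)
  open Kasami n k 𝔽

  private
    ∑^2^ : ℕ → ℕ → Carrier → Carrier
    ∑^2^ m j x = sum {m} (λ i → x ^ (2 ℕ.^ (j ℕ.+ toℕ i)))

  -- The offset j serves the induction: removing the lowest power x^(2^j) leaves a sum of the same
  -- shape with offset j + 1, whose degree is strictly larger than 2^j, so the leading coefficient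
  -- is unaffected.
  Degree-∑^2^ : ∀ m j → Degree (2 ℕ.^ (j ℕ.+ m)) (∑^2^ (suc m) j) 1#
  Degree-∑^2^ zero    j = Degree-cong _ (λ _ → sym (+-identityʳ _)) (Degree-^ _)
  Degree-∑^2^ (suc m) j =
    subst (Degree (2 ℕ.^ (j ℕ.+ suc m)) (∑^2^ (suc (suc m)) j)) (+-identityˡ 1#)
      (Degree-+ (2 ℕ.^ (j ℕ.+ suc m)) (Degree-<′ (ℕ.<⇒<′ 2^j<2^[j+1+m]) (Degree-^ _)) tail)
    where
    2^j<2^[j+1+m] : 2 ℕ.^ (j ℕ.+ 0) ℕ.< 2 ℕ.^ (j ℕ.+ suc m)
    2^j<2^[j+1+m] = ℕ.^-monoʳ-< 2 (ℕ.s≤s (ℕ.s≤s ℕ.z≤n)) (ℕ.+-monoʳ-< j (ℕ.s≤s ℕ.z≤n))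
    tail : Degree (2 ℕ.^ (j ℕ.+ suc m)) (λ x → sum {suc m} (λ i → x ^ (2 ℕ.^ (j ℕ.+ suc (toℕ i))))) 1#
    tail = Degree-cong _
      (λ x → sum-cong-≗ {suc m} (λ i → cong (λ e → x ^ (2 ℕ.^ e)) (sym (ℕ.+-suc j (toℕ i)))))
      (subst (λ e → Degree (2 ℕ.^ e) (∑^2^ (suc m) (suc j)) 1#) (sym (ℕ.+-suc j m)) (Degree-∑^2^ m (suc j)))

  Degree-Tr : 1 ℕ.≤ n → Degree (2 ℕ.^ ℕ.pred n) Tr 1#
  Degree-Tr 1≤n = go n 1≤n
    where
    go : ∀ m → 1 ℕ.≤ m → Degree (2 ℕ.^ ℕ.pred m) (λ x → sum {m} (λ i → x ^ (2 ℕ.^ toℕ i))) 1#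
    go (suc m) _ = Degree-∑^2^ m 0

  -- Otherwise a function of degree 2ⁿ⁻¹ with leading coefficient 1 would have 2ⁿ roots.
  Tr-nontrivial : 1 ℕ.≤ n → ∃[ x ] Tr x ≢ 0#
  Tr-nontrivial 1≤n with All.all? (λ x → Tr x ≟ 0#) elements
  ... | no  ¬all = let x , _ , Trx≢0 = find (¬All⇒Any¬ (λ x → Tr x ≟ 0#) elements ¬all) in x , Trx≢0
  ... | yes all  = contradiction
    (subst (ℕ._≤ 2 ℕ.^ ℕ.pred n) length-elements
      (length-roots _ (Degree-Tr 1≤n) 1#0 elements-! (All.lookup all)))
    (ℕ.<⇒≱ (ℕ.^-monoʳ-< 2 (ℕ.s≤s (ℕ.s≤s ℕ.z≤n)) (ℕ.≤-reflexive (ℕ.suc-pred n {{ℕ.>-nonZero 1≤n}}))))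

  Tr-+ : ∀ x y → Tr (x + y) ≡ Tr x + Tr y
  Tr-+ x y = trans (sum-cong-≗ {n} (λ i → ^2^-distrib-+ (toℕ i) x y)) (sum-distrib-+ {n} _ _)

  private
    sum² : ∀ m (f : Fin m → Carrier) → sum f * sum f ≡ sum (λ i → f i * f i)
    sum² zero    f = zeroˡ 0#
    sum² (suc m) f = trans
      (solve 2 (λ x y → (x :+ y) :* (x :+ y) := x :* x :+ y :* y) refl (f Fin.zero) (sum (f ∘ Fin.suc)))
      (cong (_ +_) (sum² m (f ∘ Fin.suc)))

    sum-shift : ∀ m (g : ℕ → Carrier) →
                sum {m} (λ i → g (suc (toℕ i))) + g 0 ≡ sum {m} (λ i → g (toℕ i)) + g m
    sum-shift zero    g = refl
    sum-shift (suc m) g = begin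
      g 1 + sum {m} (λ i → g (suc (suc (toℕ i)))) + g 0
        ≡⟨ cong (_+ g 0) (trans (+-comm _ _) (sum-shift m (g ∘ suc))) ⟩
      sum {m} (λ i → g (suc (toℕ i))) + g (suc m) + g 0
        ≡⟨ solve 3 (λ x y z → x :+ y :+ z := z :+ x :+ y) refl _ (g (suc m)) (g 0) ⟩
      g 0 + sum {m} (λ i → g (suc (toℕ i))) + g (suc m) ∎

    x^2^j² : ∀ x j → x ^ (2 ℕ.^ j) * x ^ (2 ℕ.^ j) ≡ x ^ (2 ℕ.^ suc j)
    x^2^j² x j = trans (sym (^-distrib-* x x (2 ℕ.^ j))) (sym (^2^suc j x))

  -- Squaring shifts the exponents 2^i to 2^(i + 1). The sum loses its first term x and gains
  -- x^(2ⁿ), which is again x.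
  Tr² : ∀ x → Tr x * Tr x ≡ Tr x
  Tr² x = begin
    Tr x * Tr x                                      ≡⟨ sum² n _ ⟩
    sum {n} (λ i → x ^ (2 ℕ.^ toℕ i) * x ^ (2 ℕ.^ toℕ i))
      ≡⟨ sum-cong-≗ {n} (λ i → x^2^j² x (toℕ i)) ⟩
    sum {n} (λ i → x ^ (2 ℕ.^ suc (toℕ i)))          ≡⟨ +-cancelʳ _ _ _ (begin
      sum {n} (λ i → x ^ (2 ℕ.^ suc (toℕ i))) + x ^ (2 ℕ.^ 0) ≡⟨ sum-shift n (λ i → x ^ (2 ℕ.^ i)) ⟩
      Tr x + x ^ (2 ℕ.^ n)                            ≡⟨ cong (Tr x +_) (x^q≡x x) ⟩
      Tr x + x                                        ≡⟨ cong (Tr x +_) (*-identityʳ x) ⟨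
      Tr x + x ^ (2 ℕ.^ 0)                            ∎) ⟩
    Tr x                                             ∎

  Tr≡0∨Tr≡1 : ∀ x → Tr x ≡ 0# ⊎ Tr x ≡ 1#
  Tr≡0∨Tr≡1 x = x²≡x⇒x≡0∨x≡1 (Tr² x)

  χ≡1 : ∀ {x} → Tr x ≡ 0# → χ x ≡ 1ℤ
  χ≡1 {x} Trx≡0 rewrite dec-true (Tr x ≟ 0#) Trx≡0 = refl

  χ≡-1 : ∀ {x} → Tr x ≡ 1# → χ x ≡ -1ℤ
  χ≡-1 {x} Trx≡1 rewrite dec-false (Tr x ≟ 0#) (λ Trx≡0 → 1#0 (trans (sym Trx≡1) Trx≡0)) = refl

  χ-+ : ∀ x y → χ (x + y) ≡ χ x ℤ.* χ y
  χ-+ x y with Tr≡0∨Tr≡1 x | Tr≡0∨Tr≡1 y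
  ... | inj₁ x≡0 | inj₁ y≡0 = trans (χ≡1 (trans (Tr-+ x y) (trans (cong₂ _+_ x≡0 y≡0) (+-identityˡ 0#))))
                                (sym (cong₂ ℤ._*_ (χ≡1 x≡0) (χ≡1 y≡0)))
  ... | inj₁ x≡0 | inj₂ y≡1 = trans (χ≡-1 (trans (Tr-+ x y) (trans (cong₂ _+_ x≡0 y≡1) (+-identityˡ 1#))))
                                (sym (cong₂ ℤ._*_ (χ≡1 x≡0) (χ≡-1 y≡1)))
  ... | inj₂ x≡1 | inj₁ y≡0 = trans (χ≡-1 (trans (Tr-+ x y) (trans (cong₂ _+_ x≡1 y≡0) (+-identityʳ 1#))))
                                (sym (cong₂ ℤ._*_ (χ≡-1 x≡1) (χ≡1 y≡0)))
  ... | inj₂ x≡1 | inj₂ y≡1 = trans (χ≡1 (trans (Tr-+ x y) (trans (cong₂ _+_ x≡1 y≡1) 1+1≡0)))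
                                (sym (cong₂ ℤ._*_ (χ≡-1 x≡1) (χ≡-1 y≡1)))

  χ-0 : χ 0# ≡ 1ℤ
  χ-0 = χ≡1 (+-cancelʳ _ _ _ (begin
    Tr 0# + Tr 0#   ≡⟨ Tr-+ 0# 0# ⟨
    Tr (0# + 0#)    ≡⟨ cong Tr (+-identityˡ 0#) ⟩
    Tr 0#           ≡⟨ +-identityˡ _ ⟨
    0# + Tr 0#      ∎))

  module _ (1≤n : 1 ℕ.≤ n) where

    -- Take x₀ of trace 1. Translating l by x₀/t permutes the field and multiplies each term by
    -- χ(x₀) = -1, so the sum is its own negative.
    ∑χ≡0 : ∀ {t} → t ≢ 0# → ∑[ l ∈ elements ] χ (l * t) ≡ 0ℤ
    ∑χ≡0 {t} t≢0 = i≡-i⇒i≡0 (begin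
      ∑[ l ∈ elements ] χ (l * t)
        ≡⟨ ∑-reindex (λ l → χ (l * t)) (_+ x₀ / t) (_+ x₀ / t) involutive involutive ⟨
      ∑[ l ∈ elements ] χ ((l + x₀ / t) * t)
        ≡⟨ ∑-cong elements (λ {l} _ → trans (cong χ (shift l)) (χ-+ x₀ (l * t))) ⟩
      ∑[ l ∈ elements ] (χ x₀ ℤ.* χ (l * t)) ≡⟨ *-distribˡ-∑ (χ x₀) elements _ ⟨
      χ x₀ ℤ.* ∑[ l ∈ elements ] χ (l * t)   ≡⟨ cong (ℤ._* (∑[ l ∈ elements ] χ (l * t))) χx₀≡-1 ⟩
      -1ℤ ℤ.* ∑[ l ∈ elements ] χ (l * t)    ≡⟨ ℤ.-1*i≡-i _ ⟩
      ℤ.- (∑[ l ∈ elements ] χ (l * t))      ∎)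
      where
      x₀ : Carrier
      x₀ = proj₁ (Tr-nontrivial 1≤n)
      χx₀≡-1 : χ x₀ ≡ -1ℤ
      χx₀≡-1 = χ≡-1 ([ (λ Tr≡0 → contradiction Tr≡0 (proj₂ (Tr-nontrivial 1≤n))) , (λ Tr≡1 → Tr≡1) ]′
                        (Tr≡0∨Tr≡1 x₀))
      involutive : ∀ l → l + x₀ / t + x₀ / t ≡ l
      involutive l = solve 2 (λ l y → l :+ y :+ y := l) refl l (x₀ / t)
      shift : ∀ l → (l + x₀ / t) * t ≡ x₀ + l * t
      shift l = trans (solve 3 (λ l y t → (l :+ y) :* t := t :* y :+ l :* t) refl l (x₀ / t) t)
                      (cong (_+ l * t) (x*[y/x]≡y x₀ t≢0))
      i≡-i⇒i≡0 : ∀ {i} → i ≡ ℤ.- i → i ≡ 0ℤ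
      -- For every other integer, i and -i have different constructors, so the remaining cases are
      -- absurd.
      i≡-i⇒i≡0 {ℤ.+ zero} _ = refl

    orthogonality : ∀ t → ∑[ l ∈ elements ] χ (l * t) ≡ ℤ.+ (2 ℕ.^ n) ℤ.* 𝟙 (t ≟ 0#)
    orthogonality t with t ≟ 0#
    ... | no  t≢0 = begin
      ∑[ l ∈ elements ] χ (l * t)       ≡⟨ ∑χ≡0 t≢0 ⟩
      0ℤ                                ≡⟨ ℤ.*-zeroʳ (ℤ.+ (2 ℕ.^ n)) ⟨
      ℤ.+ (2 ℕ.^ n) ℤ.* 0ℤ              ≡⟨ cong (ℤ.+ (2 ℕ.^ n) ℤ.*_) (𝟙-false (t ≟ 0#) t≢0) ⟨
      ℤ.+ (2 ℕ.^ n) ℤ.* 𝟙 (t ≟ 0#)      ∎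
    ... | yes t≡0 = begin
      ∑[ l ∈ elements ] χ (l * t)       ≡⟨ ∑-cong elements (λ {l} _ → χ[l*t]≡1 l) ⟩
      ∑[ l ∈ elements ] 1ℤ              ≡⟨ ∑-const 1ℤ elements ⟩
      ℤ.+ length elements ℤ.* 1ℤ        ≡⟨ cong (λ m → ℤ.+ m ℤ.* 1ℤ) length-elements ⟩
      ℤ.+ (2 ℕ.^ n) ℤ.* 1ℤ              ≡⟨ cong (ℤ.+ (2 ℕ.^ n) ℤ.*_) (𝟙-true (t ≟ 0#) t≡0) ⟨
      ℤ.+ (2 ℕ.^ n) ℤ.* 𝟙 (t ≟ 0#)      ∎
      where
      χ[l*t]≡1 : ∀ l → χ (l * t) ≡ 1ℤ
      χ[l*t]≡1 l = trans (cong χ (trans (cong (l *_) t≡0) (zeroʳ l))) χ-0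

-- The size of Δ

module KasamiDerivativeImage {c} (n k : ℕ) (coprime : gcd k n ≡ 1) (𝔽 : FiniteField c (2 ℕ.^ n)) where
  open FiniteField 𝔽 hiding (refl; sym; trans; reflexive; setoid)
  open FiniteFieldProperties 𝔽
  open BinaryFieldProperties {n = n} 𝔽
  open KasamiIsAPN n k coprime 𝔽 using (δ-two-to-one; δ-+1)
  open Kasami n k 𝔽

  Δ-! : Unique Δ
  Δ-! = DecUnique.deduplicate-! _≟_ (map δ elements)

  δ∈Δ : ∀ b → δ b ∈ Δ
  δ∈Δ b = ∈-deduplicate⁺ _≟_ (∈-map⁺ δ (∈-elements b))

  ∈Δ⇒δ : ∀ {t} → t ∈ Δ → ∃[ b ] t ≡ δ b
  ∈Δ⇒δ t∈Δ with ∈-map⁻ δ (∈-deduplicate⁻ _≟_ (map δ elements) t∈Δ)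
  ... | b , _ , t≡δb = b , t≡δb

  fibre-size : ∀ {t} → t ∈ Δ → length (filter (λ b → t ≟ δ b) elements) ≡ 2
  fibre-size {t} t∈Δ = Perm.↭-length (unique∧set⇒↭
    (Unique.filter⁺ (λ b → t ≟ δ b) elements-!) ((b≢b+1 ∷ []) ∷ [] ∷ []) to from)
    where
    b : Carrier
    b = proj₁ (∈Δ⇒δ t∈Δ)
    t≡δb : t ≡ δ b
    t≡δb = proj₂ (∈Δ⇒δ t∈Δ)
    b≢b+1 : b ≢ b + 1#
    b≢b+1 b≡b+1 = 1#0 (begin
      1#              ≡⟨ solve 1 (λ b → con true := b :+ (b :+ con true)) refl b ⟩
      b + (b + 1#)    ≡⟨ cong (b +_) b≡b+1 ⟨
      b + b           ≡⟨ x+x≡0 b ⟩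
      0#              ∎)
    to : ∀ {x} → x ∈ filter (λ b → t ≟ δ b) elements → x ∈ b ∷ b + 1# ∷ []
    to {x} x∈ = [ here , there ∘ here ]′
      (δ-two-to-one (trans (sym t≡δb) (proj₂ (∈-filter⁻ (λ b → t ≟ δ b) {xs = elements} x∈))))
    from : ∀ {x} → x ∈ b ∷ b + 1# ∷ [] → x ∈ filter (λ b → t ≟ δ b) elements
    from (here refl)         = ∈-filter⁺ (λ b → t ≟ δ b) (∈-elements _) t≡δb
    from (there (here refl)) =
      ∈-filter⁺ (λ b → t ≟ δ b) (∈-elements _) (trans t≡δb (sym (δ-+1 b)))

  value-count : ∀ b → length (filter (λ t → t ≟ δ b) Δ) ≡ 1
  value-count b = Perm.↭-length (unique∧set⇒↭
    (Unique.filter⁺ (λ t → t ≟ δ b) Δ-!) ([] ∷ [])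
    (λ x∈ → here (proj₂ (∈-filter⁻ (λ t → t ≟ δ b) {xs = Δ} x∈)))
    (λ { (here refl) → ∈-filter⁺ (λ t → t ≟ δ b) (δ∈Δ b) refl }))

  -- Double counting of the pairs (t , b) with t = δ(b): each t in Δ occurs in two of them, each b
  -- in one.
  length-Δ : length Δ ℕ.* 2 ≡ 2 ℕ.^ n
  length-Δ = ℤ.+-injective (begin
    ℤ.+ (length Δ ℕ.* 2)         ≡⟨ ℤ.pos-* (length Δ) 2 ⟩
    ℤ.+ length Δ ℤ.* ℤ.+ 2       ≡⟨ ∑-const (ℤ.+ 2) Δ ⟨
    ∑[ _ ∈ Δ ] (ℤ.+ 2)
      ≡⟨ ∑-cong Δ (λ {t} t∈Δ → trans (cong (λ m → ℤ.+ m) (sym (fibre-size t∈Δ))) (length-filter≡∑ (λ b → t ≟ δ b) elements)) ⟩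
    ∑[ t ∈ Δ ] ∑[ b ∈ elements ] 𝟙 (t ≟ δ b)   ≡⟨ ∑-comm Δ elements _ ⟩
    ∑[ b ∈ elements ] ∑[ t ∈ Δ ] 𝟙 (t ≟ δ b)
      ≡⟨ ∑-cong elements (λ {b} _ → trans (sym (length-filter≡∑ (λ t → t ≟ δ b) Δ)) (cong (λ m → ℤ.+ m) (value-count b))) ⟩
    ∑[ _ ∈ elements ] 1ℤ         ≡⟨ ∑-const 1ℤ elements ⟩
    ℤ.+ length elements ℤ.* 1ℤ   ≡⟨ ℤ.*-identityʳ _ ⟩
    ℤ.+ length elements          ≡⟨ cong (λ m → ℤ.+ m) length-elements ⟩
    ℤ.+ (2 ℕ.^ n)                ∎)

-- Counting solutions by character sums

module KasamiCounting {c} (n k : ℕ) (1≤n : 1 ℕ.≤ n) (𝔽 : FiniteField c (2 ℕ.^ n)) where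
  open FiniteField 𝔽 hiding (refl; sym; trans; reflexive; setoid)
  open FiniteFieldProperties 𝔽
  open BinaryFieldProperties {n = n} 𝔽
  open AdditiveCharacter n k 𝔽
  open Kasami n k 𝔽

  -- The subscript counts the factors `S`; the symmetric group is not meant.
  S₃ : Carrier → Carrier → Carrier → ℤ
  S₃ a b c = S a ℤ.* S b ℤ.* S c

  S₃-expand : ∀ a b c → S₃ a b c ≡
              ∑[ x ∈ Δ ] ∑[ y ∈ Δ ] ∑[ z ∈ Δ ] χ (a * x + b * y + c * z)
  S₃-expand a b c = begin
    S a ℤ.* S b ℤ.* S c              ≡⟨ cong (ℤ._* S c) (*-distribʳ-∑ (S b) Δ _) ⟩
    ∑[ x ∈ Δ ] (χ (a * x) ℤ.* S b) ℤ.* S c   ≡⟨ *-distribʳ-∑ (S c) Δ _ ⟩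
    ∑[ x ∈ Δ ] (χ (a * x) ℤ.* S b ℤ.* S c)
      ≡⟨ ∑-cong Δ (λ {x} _ → trans (cong (ℤ._* S c) (*-distribˡ-∑ (χ (a * x)) Δ _)) (*-distribʳ-∑ (S c) Δ _)) ⟩
    ∑[ x ∈ Δ ] ∑[ y ∈ Δ ] (χ (a * x) ℤ.* χ (b * y) ℤ.* S c)
      ≡⟨ ∑-cong Δ (λ {x} _ → ∑-cong Δ (λ {y} _ → *-distribˡ-∑ (χ (a * x) ℤ.* χ (b * y)) Δ _)) ⟩
    ∑[ x ∈ Δ ] ∑[ y ∈ Δ ] ∑[ z ∈ Δ ] (χ (a * x) ℤ.* χ (b * y) ℤ.* χ (c * z))
      ≡⟨ ∑-cong Δ (λ {x} _ → ∑-cong Δ (λ {y} _ → ∑-cong Δ (λ {z} _ →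
           trans (cong (ℤ._* χ (c * z)) (sym (χ-+ _ _))) (sym (χ-+ _ _))))) ⟩
    ∑[ x ∈ Δ ] ∑[ y ∈ Δ ] ∑[ z ∈ Δ ] χ (a * x + b * y + c * z) ∎

  N-formula : ∀ v₁ v₂ → ℤ.+ (2 ℕ.^ n) ℤ.* ℤ.+ N v₁ v₂ ≡
              ∑[ l ∈ elements ] S₃ (l * v₁) (l * v₂) (l * (v₁ + v₂))
  N-formula v₁ v₂ = begin
    2^n ℤ.* ℤ.+ N v₁ v₂
      ≡⟨ cong (2^n ℤ.*_) (trans (length-filter≡∑ (λ t → w t ≟ 0#) Δ³) expand) ⟩
    2^n ℤ.* ∑[ x ∈ Δ ] ∑[ y ∈ Δ ] ∑[ z ∈ Δ ] vanishes x y z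
      ≡⟨ *-distribˡ-∑ 2^n Δ (λ x → ∑[ y ∈ Δ ] ∑[ z ∈ Δ ] vanishes x y z) ⟩
    ∑[ x ∈ Δ ] (2^n ℤ.* ∑[ y ∈ Δ ] ∑[ z ∈ Δ ] vanishes x y z)
      ≡⟨ ∑-cong Δ (λ {x} _ → *-distribˡ-∑ 2^n Δ (λ y → ∑[ z ∈ Δ ] vanishes x y z)) ⟩
    ∑[ x ∈ Δ ] ∑[ y ∈ Δ ] (2^n ℤ.* ∑[ z ∈ Δ ] vanishes x y z)
      ≡⟨ ∑-cong Δ (λ {x} _ → ∑-cong Δ (λ {y} _ → trans
           (*-distribˡ-∑ 2^n Δ (vanishes x y))
           (∑-cong Δ (λ {z} _ → sym (orthogonality 1≤n (w (x , y , z))))))) ⟩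
    ∑[ x ∈ Δ ] ∑[ y ∈ Δ ] ∑[ z ∈ Δ ] ∑[ l ∈ elements ] χ (l * w (x , y , z))
      ≡⟨ ∑-cong Δ (λ _ → trans (∑-cong Δ (λ _ → ∑-comm Δ elements _)) (∑-comm Δ elements _)) ⟩
    ∑[ x ∈ Δ ] ∑[ l ∈ elements ] ∑[ y ∈ Δ ] ∑[ z ∈ Δ ] χ (l * w (x , y , z))
      ≡⟨ ∑-comm Δ elements _ ⟩
    ∑[ l ∈ elements ] ∑[ x ∈ Δ ] ∑[ y ∈ Δ ] ∑[ z ∈ Δ ] χ (l * w (x , y , z))
      ≡⟨ ∑-cong elements (λ {l} _ → trans
           (∑-cong Δ (λ {x} _ → ∑-cong Δ (λ {y} _ → ∑-cong Δ (λ {z} _ → cong χ (l*w l x y z)))))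
           (sym (S₃-expand (l * v₁) (l * v₂) (l * (v₁ + v₂))))) ⟩
    ∑[ l ∈ elements ] S₃ (l * v₁) (l * v₂) (l * (v₁ + v₂)) ∎
    where
    2^n : ℤ
    2^n = ℤ.+ (2 ℕ.^ n)
    Δ³ : List (Carrier × Carrier × Carrier)
    Δ³ = cartesianProduct Δ (cartesianProduct Δ Δ)
    w : Carrier × Carrier × Carrier → Carrier
    w (x , y , z) = v₁ * x + v₂ * y + (v₁ + v₂) * z
    vanishes : Carrier → Carrier → Carrier → ℤ
    vanishes x y z = 𝟙 (w (x , y , z) ≟ 0#)
    expand : ∑[ t ∈ Δ³ ] 𝟙 (w t ≟ 0#) ≡ ∑[ x ∈ Δ ] ∑[ y ∈ Δ ] ∑[ z ∈ Δ ] vanishes x y z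
    expand = trans (∑-cartesianProduct Δ (cartesianProduct Δ Δ) _)
                   (∑-cong Δ (λ _ → ∑-cartesianProduct Δ Δ _))
    l*w : ∀ l x y z → l * w (x , y , z) ≡ l * v₁ * x + l * v₂ * y + l * (v₁ + v₂) * z
    l*w l x y z = solve 6 (λ l a b x y z → l :* (a :* x :+ b :* y :+ (a :+ b) :* z)
      := l :* a :* x :+ l :* b :* y :+ l :* (a :+ b) :* z) refl l v₁ v₂ x y z

  private
    -- Reduces symmetries of `N` to commutativity of a product of three integers; no bijection
    -- between solution sets is needed, because 2ⁿ cancels.
    N-cong-∑ : ∀ {v₁ v₂ w₁ w₂} →
      (∀ l → S₃ (l * v₁) (l * v₂) (l * (v₁ + v₂)) ≡ S₃ (l * w₁) (l * w₂) (l * (w₁ + w₂))) →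
      N v₁ v₂ ≡ N w₁ w₂
    N-cong-∑ {v₁} {v₂} {w₁} {w₂} eq = ℤ.+-injective (ℤ.*-cancelˡ-≡ (ℤ.+ (2 ℕ.^ n)) _ _
      {{ℕ.m^n≢0 2 n}}
      (trans (N-formula v₁ v₂) (trans (∑-cong elements (λ {l} _ → eq l)) (sym (N-formula w₁ w₂)))))

  N-comm : ∀ v₁ v₂ → N v₁ v₂ ≡ N v₂ v₁
  N-comm v₁ v₂ = N-cong-∑ (λ l → cong₂ ℤ._*_ (ℤ.*-comm (S (l * v₁)) (S (l * v₂)))
                                             (cong (λ v → S (l * v)) (+-comm v₁ v₂)))

  N-shift : ∀ v₁ v₂ → N v₁ v₂ ≡ N v₁ (v₁ + v₂)
  N-shift v₁ v₂ = N-cong-∑ (λ l → trans (*-swap (S (l * v₁)) (S (l * v₂)) (S (l * (v₁ + v₂))))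
    (cong (λ v → S₃ (l * v₁) (l * (v₁ + v₂)) (l * v))
      (solve 2 (λ x y → y := x :+ (x :+ y)) refl v₁ v₂)))
    where
    *-swap : ∀ i j m → i ℤ.* j ℤ.* m ≡ i ℤ.* m ℤ.* j
    *-swap = solve-∀

  -- The defining equation is homogeneous in the coefficients, so the solution set itself does not
  -- change.
  N-scale : ∀ {a} → a ≢ 0# → ∀ v₁ v₂ → N (a * v₁) (a * v₂) ≡ N v₁ v₂
  N-scale {a} a≢0 v₁ v₂ = cong length (filter-≐ (λ t → w (a * v₁) (a * v₂) t ≟ 0#) (λ t → w v₁ v₂ t ≟ 0#)
    ( (λ {t} aw≡0 → *-cancelˡ-nonZero a≢0 (trans (sym (factor t)) (trans aw≡0 (sym (zeroʳ a)))))
    , (λ {t} w≡0 → trans (factor t) (trans (cong (a *_) w≡0) (zeroʳ a)))) (cartesianProduct Δ (cartesianProduct Δ Δ)))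
    where
    w : Carrier → Carrier → Carrier × Carrier × Carrier → Carrier
    w v₁ v₂ (x , y , z) = v₁ * x + v₂ * y + (v₁ + v₂) * z
    factor : ∀ t → w (a * v₁) (a * v₂) t ≡ a * w v₁ v₂ t
    factor (x , y , z) = solve 6 (λ a b c x y z →
      a :* b :* x :+ a :* c :* y :+ (a :* b :+ a :* c) :* z := a :* (b :* x :+ c :* y :+ (b :+ c) :* z))
      refl a v₁ v₂ x y z

  N-ratio : ∀ {v₁} → v₁ ≢ 0# → ∀ v₂ → N v₁ v₂ ≡ N 1# (v₂ / v₁)
  N-ratio {v₁} v₁≢0 v₂ = trans (cong₂ N (sym (*-identityʳ v₁)) (sym (x*[y/x]≡y v₂ v₁≢0)))
                               (N-scale v₁≢0 1# (v₂ / v₁))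

  2^n*N≡Δ³+Z : ∀ {v₁} → v₁ ≢ 0# → ∀ v₂ → ℤ.+ (2 ℕ.^ n) ℤ.* ℤ.+ N v₁ v₂ ≡
        ℤ.+ (length Δ ℕ.* length Δ ℕ.* length Δ) ℤ.+ Z (v₂ / v₁)
  2^n*N≡Δ³+Z {v₁} v₁≢0 v₂ = begin
    ℤ.+ (2 ℕ.^ n) ℤ.* ℤ.+ N v₁ v₂                          ≡⟨ N-formula v₁ v₂ ⟩
    ∑[ l ∈ elements ] S₃ (l * v₁) (l * v₂) (l * (v₁ + v₂))
      ≡⟨ ∑-cong elements (λ {l} _ → rescale l) ⟩
    ∑[ l ∈ elements ] H (v₁ * l)                           ≡⟨ ∑-↭ (λ l → H (v₁ * l)) elements↭0∷nonZeros ⟩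
    H (v₁ * 0#) ℤ.+ ∑[ l ∈ nonZeros ] H (v₁ * l)
      ≡⟨ cong₂ ℤ._+_ (trans (cong H (zeroʳ v₁)) H-0) (trans (sym (∑-map H (v₁ *_) nonZeros)) (∑-↭ H (map-*-↭ v₁≢0))) ⟩
    ℤ.+ (length Δ ℕ.* length Δ ℕ.* length Δ) ℤ.+ Z ρ       ∎
    where
    ρ : Carrier
    ρ = v₂ / v₁
    H : Carrier → ℤ
    H l = S₃ l (l * ρ) (l * (1# + ρ))
    v₁ρ : v₁ * ρ ≡ v₂
    v₁ρ = x*[y/x]≡y v₂ v₁≢0
    rescale : ∀ l → S₃ (l * v₁) (l * v₂) (l * (v₁ + v₂)) ≡ H (v₁ * l)
    rescale l = trans (cong (λ v → S₃ (l * v₁) (l * v) (l * (v₁ + v))) (sym v₁ρ))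
      (trans (cong₂ (λ x y → S₃ x y (l * (v₁ + v₁ * ρ)))
         (*-comm l v₁) (solve 3 (λ l v r → l :* (v :* r) := v :* l :* r) refl l v₁ ρ))
      (cong (S₃ (v₁ * l) (v₁ * l * ρ))
         (solve 3 (λ l v r → l :* (v :+ v :* r) := v :* l :* (con true :+ r)) refl l v₁ ρ)))
    S-0 : S 0# ≡ ℤ.+ length Δ
    S-0 = trans (∑-cong Δ (λ {t} _ → trans (cong χ (zeroˡ t)) χ-0))
                (trans (∑-const 1ℤ Δ) (ℤ.*-identityʳ _))
    H-0 : H 0# ≡ ℤ.+ (length Δ ℕ.* length Δ ℕ.* length Δ)
    H-0 = begin
      S₃ 0# (0# * ρ) (0# * (1# + ρ))   ≡⟨ cong₂ (S₃ 0#) (zeroˡ ρ) (zeroˡ (1# + ρ)) ⟩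
      S 0# ℤ.* S 0# ℤ.* S 0#           ≡⟨ cong (λ i → i ℤ.* i ℤ.* i) S-0 ⟩
      ℤ.+ length Δ ℤ.* ℤ.+ length Δ ℤ.* ℤ.+ length Δ
        ≡⟨ cong (ℤ._* ℤ.+ length Δ) (ℤ.pos-* (length Δ) (length Δ)) ⟨
      ℤ.+ (length Δ ℕ.* length Δ) ℤ.* ℤ.+ length Δ  ≡⟨ ℤ.pos-* (length Δ ℕ.* length Δ) (length Δ) ⟨
      ℤ.+ (length Δ ℕ.* length Δ ℕ.* length Δ) ∎

fromℤ-+ : ∀ i j → fromℤ (i ℤ.+ j) ≡ fromℤ i ℚ.+ fromℤ j
fromℤ-+ i j = ℚ.toℚᵘ-injective (ℚᵘ.≃-trans (ℚ.toℚᵘ-fromℚᵘ (mkℚᵘ (i ℤ.+ j) 0)) (ℚᵘ.≃-trans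
  (*≡* (lemma i j)) (ℚᵘ.≃-sym (ℚᵘ.≃-trans (ℚ.toℚᵘ-homo-+ (fromℤ i) (fromℤ j))
    (ℚᵘ.+-cong (ℚ.toℚᵘ-fromℚᵘ (mkℚᵘ i 0)) (ℚ.toℚᵘ-fromℚᵘ (mkℚᵘ j 0)))))))
  where
  lemma : ∀ i j → (i ℤ.+ j) ℤ.* 1ℤ ≡ (i ℤ.* 1ℤ ℤ.+ j ℤ.* 1ℤ) ℤ.* 1ℤ
  lemma = solve-∀

fromℤ-* : ∀ i j → fromℤ (i ℤ.* j) ≡ fromℤ i ℚ.* fromℤ j
fromℤ-* i j = ℚ.toℚᵘ-injective (ℚᵘ.≃-trans (ℚ.toℚᵘ-fromℚᵘ (mkℚᵘ (i ℤ.* j) 0)) (ℚᵘ.≃-sym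
  (ℚᵘ.≃-trans (ℚ.toℚᵘ-homo-* (fromℤ i) (fromℤ j))
    (ℚᵘ.*-cong (ℚ.toℚᵘ-fromℚᵘ (mkℚᵘ i 0)) (ℚ.toℚᵘ-fromℚᵘ (mkℚᵘ j 0))))))

fromℤ-injective : ∀ {i j} → fromℤ i ≡ fromℤ j → i ≡ j
fromℤ-injective {i} {j} eq with ℚᵘ.≃-trans (ℚᵘ.≃-sym (ℚ.toℚᵘ-fromℚᵘ (mkℚᵘ i 0)))
  (ℚᵘ.≃-trans (ℚᵘ.≃-reflexive (cong ℚ.toℚᵘ eq)) (ℚ.toℚᵘ-fromℚᵘ (mkℚᵘ j 0)))
... | *≡* i*1≡j*1 = trans (sym (ℤ.*-identityʳ i)) (trans i*1≡j*1 (ℤ.*-identityʳ j))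

1/d*d≡1 : ∀ d .{{_ : ℕ.NonZero d}} → (1ℤ ℚ./ d) ℚ.* fromℕ d ≡ 1ℚ
1/d*d≡1 (suc d) = ℚ.toℚᵘ-injective (ℚᵘ.≃-trans (ℚ.toℚᵘ-homo-* (1ℤ ℚ./ suc d) (fromℕ (suc d)))
  (ℚᵘ.≃-trans (ℚᵘ.*-cong (ℚ.toℚᵘ-fromℚᵘ (mkℚᵘ 1ℤ d)) (ℚ.toℚᵘ-fromℚᵘ (mkℚᵘ (ℤ.+ suc d) 0)))
    (*≡* (trans (lemma (ℤ.+ suc d)) (cong (λ m → 1ℤ ℤ.* ℤ.+ m) (sym (ℕ.*-identityʳ (suc d))))))))
  where
  lemma : ∀ i → 1ℤ ℤ.* i ℤ.* 1ℤ ≡ 1ℤ ℤ.* i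
  lemma = solve-∀

2^-n*2^n≡1 : ∀ n → 2^ (ℤ.- (ℤ.+ n)) ℚ.* fromℕ (2 ℕ.^ n) ≡ 1ℚ
2^-n*2^n≡1 zero    = refl
2^-n*2^n≡1 (suc n) = 1/d*d≡1 (2 ℕ.^ suc n) {{ℕ.m^n≢0 2 (suc n)}}

main-term : ℕ → ℚ
main-term n = 2^ (ℤ.+ 2 ℤ.* ℤ.+ n ℤ.- ℤ.+ 3)

2^n*main-term : ∀ n → fromℕ (2 ℕ.^ suc n) ℚ.* main-term (suc n) ≡ fromℕ (2 ℕ.^ n ℕ.* 2 ℕ.^ n ℕ.* 2 ℕ.^ n)
2^n*main-term zero    = refl
2^n*main-term (suc n) = begin
  fromℕ (2 ℕ.* (2 ℕ.* 2 ℕ.^ n)) ℚ.* main-term (suc (suc n))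
    ≡⟨ cong (λ e → fromℕ (2 ℕ.* (2 ℕ.* 2 ℕ.^ n)) ℚ.* 2^ e) exponent ⟩
  fromℕ (2 ℕ.* (2 ℕ.* 2 ℕ.^ n)) ℚ.* fromℕ (2 ℕ.^ suc (n ℕ.+ n))
    ≡⟨ fromℤ-* (ℤ.+ (2 ℕ.* (2 ℕ.* 2 ℕ.^ n))) (ℤ.+ (2 ℕ.^ suc (n ℕ.+ n))) ⟨
  fromℤ (ℤ.+ (2 ℕ.* (2 ℕ.* 2 ℕ.^ n)) ℤ.* ℤ.+ (2 ℕ.^ suc (n ℕ.+ n)))
    ≡⟨ cong fromℤ (ℤ.pos-* (2 ℕ.* (2 ℕ.* 2 ℕ.^ n)) (2 ℕ.^ suc (n ℕ.+ n))) ⟨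
  fromℕ (2 ℕ.* (2 ℕ.* 2 ℕ.^ n) ℕ.* (2 ℕ.* 2 ℕ.^ (n ℕ.+ n)))
    ≡⟨ cong (λ m → fromℕ (2 ℕ.* (2 ℕ.* 2 ℕ.^ n) ℕ.* (2 ℕ.* m))) (ℕ.^-distribˡ-+-* 2 n n) ⟩
  fromℕ (2 ℕ.* (2 ℕ.* 2 ℕ.^ n) ℕ.* (2 ℕ.* (2 ℕ.^ n ℕ.* 2 ℕ.^ n)))
    ≡⟨ cong fromℕ (lemma (2 ℕ.^ n)) ⟩
  fromℕ (2 ℕ.* 2 ℕ.^ n ℕ.* (2 ℕ.* 2 ℕ.^ n) ℕ.* (2 ℕ.* 2 ℕ.^ n)) ∎
  where
  lemma : ∀ a → 2 ℕ.* (2 ℕ.* a) ℕ.* (2 ℕ.* (a ℕ.* a)) ≡ 2 ℕ.* a ℕ.* (2 ℕ.* a) ℕ.* (2 ℕ.* a)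
  lemma = ℕSolver.solve-∀
  double : ∀ i → ℤ.+ 2 ℤ.* (ℤ.+ 2 ℤ.+ i) ℤ.- ℤ.+ 3 ≡ 1ℤ ℤ.+ (i ℤ.+ i)
  double = solve-∀
  exponent : ℤ.+ 2 ℤ.* ℤ.+ suc (suc n) ℤ.- ℤ.+ 3 ≡ ℤ.+ suc (n ℕ.+ n)
  exponent = double (ℤ.+ n)

divide-by-2^n : ∀ n → 1 ℕ.≤ n → ∀ {m} L i → L ℕ.* 2 ≡ 2 ℕ.^ n →
  ℤ.+ (2 ℕ.^ n) ℤ.* ℤ.+ m ≡ ℤ.+ (L ℕ.* L ℕ.* L) ℤ.+ i →
  fromℕ m ≡ main-term n ℚ.+ 2^ (ℤ.- (ℤ.+ n)) ℚ.* fromℤ i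
divide-by-2^n (suc n) _ {m} L i L*2≡2^n eq = begin
  fromℕ m                         ≡⟨ cancel (fromℕ m) ⟨
  u ℚ.* (v ℚ.* fromℕ m)           ≡⟨ cong (u ℚ.*_) (fromℤ-* (ℤ.+ (2 ℕ.^ suc n)) (ℤ.+ m)) ⟨
  u ℚ.* fromℤ (ℤ.+ (2 ℕ.^ suc n) ℤ.* ℤ.+ m)      ≡⟨ cong (λ j → u ℚ.* fromℤ j) eq ⟩
  u ℚ.* fromℤ (ℤ.+ (L ℕ.* L ℕ.* L) ℤ.+ i)        ≡⟨ cong (u ℚ.*_) (fromℤ-+ (ℤ.+ (L ℕ.* L ℕ.* L)) i) ⟩
  u ℚ.* (fromℕ (L ℕ.* L ℕ.* L) ℚ.+ fromℤ i)      ≡⟨ ℚ.*-distribˡ-+ u _ _ ⟩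
  u ℚ.* fromℕ (L ℕ.* L ℕ.* L) ℚ.+ u ℚ.* fromℤ i
    ≡⟨ cong (λ l → u ℚ.* fromℕ (l ℕ.* l ℕ.* l) ℚ.+ u ℚ.* fromℤ i)
         (ℕ.*-cancelʳ-≡ L (2 ℕ.^ n) 2 (trans L*2≡2^n (ℕ.*-comm 2 (2 ℕ.^ n)))) ⟩
  u ℚ.* fromℕ (2 ℕ.^ n ℕ.* 2 ℕ.^ n ℕ.* 2 ℕ.^ n) ℚ.+ u ℚ.* fromℤ i
    ≡⟨ cong (λ x → u ℚ.* x ℚ.+ u ℚ.* fromℤ i) (2^n*main-term n) ⟨
  u ℚ.* (v ℚ.* main-term (suc n)) ℚ.+ u ℚ.* fromℤ i
    ≡⟨ cong (ℚ._+ u ℚ.* fromℤ i) (cancel (main-term (suc n))) ⟩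
  main-term (suc n) ℚ.+ u ℚ.* fromℤ i ∎
  where
  u v : ℚ
  u = 2^ (ℤ.- (ℤ.+ suc n))
  v = fromℕ (2 ℕ.^ suc n)
  cancel : ∀ x → u ℚ.* (v ℚ.* x) ≡ x
  cancel x = trans (sym (ℚ.*-assoc u v x)) (trans (cong (ℚ._* x) (2^-n*2^n≡1 (suc n))) (ℚ.*-identityˡ x))

x+2^-n*i≡x⇒i≡0 : ∀ n {x i} → x ℚ.+ 2^ (ℤ.- (ℤ.+ n)) ℚ.* fromℤ i ≡ x → i ≡ 0ℤ
x+2^-n*i≡x⇒i≡0 n {x} {i} eq = fromℤ-injective (begin
  fromℤ i                     ≡⟨ ℚ.*-identityˡ _ ⟨
  1ℚ ℚ.* fromℤ i              ≡⟨ cong (ℚ._* fromℤ i) (trans (ℚ.*-comm v u) (2^-n*2^n≡1 n)) ⟨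
  v ℚ.* u ℚ.* fromℤ i         ≡⟨ ℚ.*-assoc v u _ ⟩
  v ℚ.* (u ℚ.* fromℤ i)       ≡⟨ cong (v ℚ.*_) (identityʳ-unique x _ eq) ⟩
  v ℚ.* 0ℚ                    ≡⟨ ℚ.*-zeroʳ v ⟩
  0ℚ                          ∎)
  where
  u v : ℚ
  u = 2^ (ℤ.- (ℤ.+ n))
  v = fromℕ (2 ℕ.^ n)

⟨$⟩ˡ-injective : ∀ {n} (π : Permutation′ n) {i j} → π ⟨$⟩ˡ i ≡ π ⟨$⟩ˡ j → i ≡ j
⟨$⟩ˡ-injective π eq = trans (sym (inverseʳ π)) (trans (cong (π ⟨$⟩ʳ_) eq) (inverseʳ π))

⟨$⟩ˡ-cong : ∀ {n} {π τ : Permutation′ n} → π ≈ₚ τ → ∀ i → π ⟨$⟩ˡ i ≡ τ ⟨$⟩ˡ i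
⟨$⟩ˡ-cong {π = π} {τ} π≈τ i = begin
  π ⟨$⟩ˡ i                      ≡⟨ inverseˡ τ ⟨
  τ ⟨$⟩ˡ (τ ⟨$⟩ʳ (π ⟨$⟩ˡ i))     ≡⟨ cong (τ ⟨$⟩ˡ_) (π≈τ (π ⟨$⟩ˡ i)) ⟨
  τ ⟨$⟩ˡ (π ⟨$⟩ʳ (π ⟨$⟩ˡ i))     ≡⟨ cong (τ ⟨$⟩ˡ_) (inverseʳ π) ⟩
  τ ⟨$⟩ˡ i                      ∎

-- S₃ permutes the coordinates of (1 , ρ , 1 + ρ), whose entries sum to zero,
-- up to scaling; ρ is recovered as the ratio of the first two coordinates.
module S₃Action {c} (n k : ℕ) (1≤n : 1 ℕ.≤ n) (𝔽 : FiniteField c (2 ℕ.^ n)) where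
  open FiniteField 𝔽 hiding (refl; sym; trans; reflexive; setoid)
  open FiniteFieldProperties 𝔽
  open BinaryFieldProperties {n = n} 𝔽
  open KasamiCounting n k 1≤n 𝔽
  open Kasami n k 𝔽

  coordinate : Carrier → Fin 3 → Carrier
  coordinate ρ 0F = 1#
  coordinate ρ 1F = ρ
  coordinate ρ 2F = 1# + ρ

  coordinate-nonZero : ∀ {ρ} → ≢0,1 ρ → ∀ i → coordinate ρ i ≢ 0#
  coordinate-nonZero (ρ≢0 , ρ≢1) 0F = 1#0
  coordinate-nonZero (ρ≢0 , ρ≢1) 1F = ρ≢0
  coordinate-nonZero (ρ≢0 , ρ≢1) 2F = ρ≢1 ∘ sym ∘ x+y≡0⇒x≡y

  coordinate-+ : ∀ ρ i j l → i ≢ j → j ≢ l → i ≢ l →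
                 coordinate ρ i + coordinate ρ j ≡ coordinate ρ l
  coordinate-+ ρ 0F 1F 2F _ _ _ = refl
  coordinate-+ ρ 0F 2F 1F _ _ _ = solve 1 (λ r → con true :+ (con true :+ r) := r) refl ρ
  coordinate-+ ρ 1F 0F 2F _ _ _ = +-comm ρ 1#
  coordinate-+ ρ 1F 2F 0F _ _ _ = solve 1 (λ r → r :+ (con true :+ r) := con true) refl ρ
  coordinate-+ ρ 2F 0F 1F _ _ _ = solve 1 (λ r → (con true :+ r) :+ con true := r) refl ρ
  coordinate-+ ρ 2F 1F 0F _ _ _ = solve 1 (λ r → (con true :+ r) :+ r := con true) refl ρ
  coordinate-+ ρ 0F 0F _  i≢j _ _ = contradiction refl i≢j
  coordinate-+ ρ 1F 1F _  i≢j _ _ = contradiction refl i≢j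
  coordinate-+ ρ 2F 2F _  i≢j _ _ = contradiction refl i≢j
  coordinate-+ ρ _  0F 0F _ j≢l _ = contradiction refl j≢l
  coordinate-+ ρ _  1F 1F _ j≢l _ = contradiction refl j≢l
  coordinate-+ ρ _  2F 2F _ j≢l _ = contradiction refl j≢l
  coordinate-+ ρ 0F _  0F _ _ i≢l = contradiction refl i≢l
  coordinate-+ ρ 1F _  1F _ _ i≢l = contradiction refl i≢l
  coordinate-+ ρ 2F _  2F _ _ i≢l = contradiction refl i≢l

  coordinate-permuted-+ : ∀ ρ (π : Permutation′ 3) →
    coordinate ρ (π ⟨$⟩ˡ 0F) + coordinate ρ (π ⟨$⟩ˡ 1F) ≡ coordinate ρ (π ⟨$⟩ˡ 2F)
  coordinate-permuted-+ ρ π = coordinate-+ ρ _ _ _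
    ((λ ()) ∘ ⟨$⟩ˡ-injective π {0F} {1F}) ((λ ()) ∘ ⟨$⟩ˡ-injective π {1F} {2F})
    ((λ ()) ∘ ⟨$⟩ˡ-injective π {0F} {2F})

  act : Permutation′ 3 → Carrier → Carrier
  act π ρ = coordinate ρ (π ⟨$⟩ˡ 1F) / coordinate ρ (π ⟨$⟩ˡ 0F)

  coordinate-act : ∀ π {ρ} → ≢0,1 ρ → ∀ i →
    coordinate ρ (π ⟨$⟩ˡ 0F) * coordinate (act π ρ) i ≡ coordinate ρ (π ⟨$⟩ˡ i)
  coordinate-act π     ρ≢0,1 0F = *-identityʳ _
  coordinate-act π {ρ} ρ≢0,1 1F = x*[y/x]≡y _ (coordinate-nonZero ρ≢0,1 (π ⟨$⟩ˡ 0F))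
  coordinate-act π {ρ} ρ≢0,1 2F = begin
    x₀ * (1# + act π ρ)          ≡⟨ solve 2 (λ x y → x :* (con true :+ y) := x :+ x :* y) refl x₀ (act π ρ) ⟩
    x₀ + x₀ * act π ρ            ≡⟨ cong (x₀ +_) (coordinate-act π ρ≢0,1 1F) ⟩
    x₀ + coordinate ρ (π ⟨$⟩ˡ 1F) ≡⟨ coordinate-permuted-+ ρ π ⟩
    coordinate ρ (π ⟨$⟩ˡ 2F)      ∎
    where
    x₀ : Carrier
    x₀ = coordinate ρ (π ⟨$⟩ˡ 0F)

  act-≢0,1 : ∀ π {ρ} → ≢0,1 ρ → ≢0,1 (act π ρ)
  act-≢0,1 π {ρ} ρ≢0,1 =
      (λ ≡0 → x≢0 1F (trans (sym (coordinate-act π ρ≢0,1 1F)) (trans (cong (x 0F *_) ≡0) (zeroʳ _))))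
    , (λ ≡1 → x≢0 2F (begin
        x 2F                  ≡⟨ coordinate-act π ρ≢0,1 2F ⟨
        x 0F * (1# + act π ρ) ≡⟨ cong (λ y → x 0F * (1# + y)) ≡1 ⟩
        x 0F * (1# + 1#)      ≡⟨ cong (x 0F *_) 1+1≡0 ⟩
        x 0F * 0#             ≡⟨ zeroʳ _ ⟩
        0#                    ∎))
    where
    x : Fin 3 → Carrier
    x i = coordinate ρ (π ⟨$⟩ˡ i)
    x≢0 : ∀ i → x i ≢ 0#
    x≢0 i = coordinate-nonZero ρ≢0,1 (π ⟨$⟩ˡ i)

  x/1≡x : ∀ x → x / 1# ≡ x
  x/1≡x x = y≡x*z⇒y/x≡z 1#0 (sym (*-identityˡ x))

  act-∘ₚ : ∀ π τ {ρ} → ≢0,1 ρ → act (τ ∘ₚ π) ρ ≡ act π (act τ ρ)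
  act-∘ₚ π τ {ρ} ρ≢0,1 = y≡x*z⇒y/x≡z (coordinate-nonZero ρ≢0,1 (τ ⟨$⟩ˡ (π ⟨$⟩ˡ 0F))) (begin
    coordinate ρ (τ ⟨$⟩ˡ (π ⟨$⟩ˡ 1F))        ≡⟨ coordinate-act τ ρ≢0,1 (π ⟨$⟩ˡ 1F) ⟨
    x₀ * coordinate ρ′ (π ⟨$⟩ˡ 1F)
      ≡⟨ cong (x₀ *_) (coordinate-act π (act-≢0,1 τ ρ≢0,1) 1F) ⟨
    x₀ * (coordinate ρ′ (π ⟨$⟩ˡ 0F) * act π ρ′)  ≡⟨ *-assoc x₀ _ _ ⟨
    x₀ * coordinate ρ′ (π ⟨$⟩ˡ 0F) * act π ρ′
      ≡⟨ cong (_* act π ρ′) (coordinate-act τ ρ≢0,1 (π ⟨$⟩ˡ 0F)) ⟩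
    coordinate ρ (τ ⟨$⟩ˡ (π ⟨$⟩ˡ 0F)) * act π ρ′ ∎)
    where
    x₀ ρ′ : Carrier
    x₀ = coordinate ρ (τ ⟨$⟩ˡ 0F)
    ρ′ = act τ ρ

  action : S₃-Action ≢0,1
  action = record
    { act      = act
    ; act-P    = act-≢0,1
    ; act-cong = λ {π} {τ} π≈τ {ρ} _ → cong₂ (λ i j → coordinate ρ i / coordinate ρ j)
                   (⟨$⟩ˡ-cong {π = π} {τ} π≈τ 1F) (⟨$⟩ˡ-cong {π = π} {τ} π≈τ 0F)
    ; act-id   = λ {ρ} _ → x/1≡x ρ
    ; act-∘    = act-∘ₚ
    }

  N-coordinate : ∀ ρ i j → i ≢ j → N (coordinate ρ i) (coordinate ρ j) ≡ N 1# ρ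
  N-coordinate ρ 0F 1F _ = refl
  N-coordinate ρ 0F 2F _ = sym (N-shift 1# ρ)
  N-coordinate ρ 1F 0F _ = N-comm ρ 1#
  N-coordinate ρ 2F 0F _ = trans (N-comm (1# + ρ) 1#) (sym (N-shift 1# ρ))
  N-coordinate ρ 1F 2F _ = begin
    N ρ (1# + ρ)   ≡⟨ cong (N ρ) (+-comm 1# ρ) ⟩
    N ρ (ρ + 1#)   ≡⟨ N-shift ρ 1# ⟨
    N ρ 1#         ≡⟨ N-comm ρ 1# ⟩
    N 1# ρ         ∎
  N-coordinate ρ 2F 1F _ = trans (N-comm (1# + ρ) ρ) (N-coordinate ρ 1F 2F (λ ()))
  N-coordinate ρ 0F 0F i≢j = contradiction refl i≢j
  N-coordinate ρ 1F 1F i≢j = contradiction refl i≢j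
  N-coordinate ρ 2F 2F i≢j = contradiction refl i≢j

  N-act : ∀ π {ρ} → ≢0,1 ρ → N 1# (act π ρ) ≡ N 1# ρ
  N-act π {ρ} ρ≢0,1 = trans (sym (N-ratio (coordinate-nonZero ρ≢0,1 (π ⟨$⟩ˡ 0F)) _))
    (N-coordinate ρ _ _ ((λ ()) ∘ ⟨$⟩ˡ-injective π {0F} {1F}))

open import Data.Integer.Base as ℤ using (+_; 0ℤ)

proposition4p1 :
    ∀ {c} (k n : ℕ) → 1 ℕ.≤ k → 1 ℕ.≤ n → gcd k n ≡ 1 →
    (𝔽 : FiniteField c (2 ℕ.^ n)) →
    let open FiniteField 𝔽
        open Kasami n k 𝔽
        2^[2n-3] = 2^ (+ 2 ℤ.* + n ℤ.- + 3)
    in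
    (∀ v₁ v₂ → v₁ ≢ 0# → v₂ ≢ 0# → v₁ ≢ v₂ →
      let v₃ = v₁ + v₂
          ρ  = v₂ / v₁
          σ  = 1# + ρ
      in
      ≢0,1 ρ ×
      σ ≡ v₃ / v₁ ×
      fromℕ (N v₁ v₂) ≡ 2^[2n-3] ℚ.+ 2^ (ℤ.- + n) ℚ.* fromℤ (Z ρ) ×
      N v₁ v₂ ≡ N 1# ρ) ×
    ((∀ v₁ v₂ → v₁ ≢ 0# → v₂ ≢ 0# → v₁ ≢ v₂ → fromℕ (N v₁ v₂) ≡ 2^[2n-3])
      ⇔ (∀ ρ → ≢0,1 ρ → Z ρ ≡ 0ℤ)) ×
    (Σ[ A ∈ S₃-Action ≢0,1 ]
      let open S₃-Action A in
      (∀ ρ → ≢0,1 ρ → act (transpose 0F 1F) ρ ≡ 1# / ρ) ×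
      (∀ ρ → ≢0,1 ρ → act (transpose 1F 2F) ρ ≡ 1# + ρ) ×
      (∀ π ρ → ≢0,1 ρ → N 1# (act π ρ) ≡ N 1# ρ))
proposition4p1 k n 1≤k 1≤n coprime 𝔽 =
    (λ v₁ v₂ v₁≢0 v₂≢0 v₁≢v₂ →
        ratio-≢0,1 v₁≢0 v₂≢0 v₁≢v₂
      , sym (y≡x*z⇒y/x≡z v₁≢0 (sym (v₁*[1+ρ]≡v₁+v₂ v₁≢0 v₂)))
      , formula v₁≢0 v₂
      , N-ratio v₁≢0 v₂)
  , mk⇔ (λ N≡main-term ρ (ρ≢0 , ρ≢1) → x+2^-n*i≡x⇒i≡0 n (begin
             main-term n ℚ.+ 2^ (ℤ.- (+ n)) ℚ.* fromℤ (Z ρ)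
               ≡⟨ cong (λ r → main-term n ℚ.+ 2^ (ℤ.- (+ n)) ℚ.* fromℤ (Z r)) (x/1≡x ρ) ⟨
             main-term n ℚ.+ 2^ (ℤ.- (+ n)) ℚ.* fromℤ (Z (ρ / 1#))  ≡⟨ formula 1#0 ρ ⟨
             fromℕ (N 1# ρ)   ≡⟨ N≡main-term 1# ρ 1#0 ρ≢0 (ρ≢1 ∘ sym) ⟩
             main-term n      ∎))
        (λ Z≡0 v₁ v₂ v₁≢0 v₂≢0 v₁≢v₂ → begin
             fromℕ (N v₁ v₂)  ≡⟨ formula v₁≢0 v₂ ⟩
             main-term n ℚ.+ 2^ (ℤ.- (+ n)) ℚ.* fromℤ (Z (v₂ / v₁))
               ≡⟨ cong (λ i → main-term n ℚ.+ 2^ (ℤ.- (+ n)) ℚ.* fromℤ i) (Z≡0 _ (ratio-≢0,1 v₁≢0 v₂≢0 v₁≢v₂)) ⟩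
             main-term n ℚ.+ 2^ (ℤ.- (+ n)) ℚ.* fromℤ 0ℤ
               ≡⟨ cong (main-term n ℚ.+_) (ℚ.*-zeroʳ (2^ (ℤ.- (+ n)))) ⟩
             main-term n ℚ.+ fromℤ 0ℤ  ≡⟨ ℚ.+-identityʳ (main-term n) ⟩
             main-term n      ∎)
  , action , (λ _ _ → refl) , (λ ρ _ → x/1≡x (1# + ρ)) , (λ π _ → N-act π)
  where
  open FiniteField 𝔽 hiding (refl; sym; trans; reflexive; setoid)
  open FiniteFieldProperties 𝔽
  open BinaryFieldProperties {n = n} 𝔽
  open KasamiDerivativeImage n k coprime 𝔽
  open KasamiCounting n k 1≤n 𝔽
  open S₃Action n k 1≤n 𝔽
  open Kasami n k 𝔽

  formula : ∀ {v₁} → v₁ ≢ 0# → ∀ v₂ →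
            fromℕ (N v₁ v₂) ≡ main-term n ℚ.+ 2^ (ℤ.- (+ n)) ℚ.* fromℤ (Z (v₂ / v₁))
  formula {v₁} v₁≢0 v₂ = divide-by-2^n n 1≤n (length Δ) (Z (v₂ / v₁)) length-Δ (2^n*N≡Δ³+Z v₁≢0 v₂)

  ratio-≢0,1 : ∀ {v₁ v₂} → v₁ ≢ 0# → v₂ ≢ 0# → v₁ ≢ v₂ → ≢0,1 (v₂ / v₁)
  ratio-≢0,1 {v₁} {v₂} v₁≢0 v₂≢0 v₁≢v₂ = x*y≢0 v₂≢0 (⁻¹-nonZero v₁≢0) , λ v₂/v₁≡1 → v₁≢v₂ (begin
    v₁              ≡⟨ *-identityʳ v₁ ⟨
    v₁ * 1#         ≡⟨ cong (v₁ *_) v₂/v₁≡1 ⟨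
    v₁ * (v₂ / v₁)  ≡⟨ x*[y/x]≡y v₂ v₁≢0 ⟩
    v₂              ∎)

  v₁*[1+ρ]≡v₁+v₂ : ∀ {v₁} → v₁ ≢ 0# → ∀ v₂ → v₁ * (1# + v₂ / v₁) ≡ v₁ + v₂
  v₁*[1+ρ]≡v₁+v₂ {v₁} v₁≢0 v₂ = trans (distribˡ v₁ 1# _)
    (cong₂ _+_ (*-identityʳ v₁) (x*[y/x]≡y v₂ v₁≢0))
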